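{- Algorithm NG is a $\bigl(4k\ln(\tfrac1\epsilon)+8k\bigr)$-approximation for SRMA: for every instance $I$ of SRMA with $k$ agents and minimum non-zero marginal value $\epsilon$, the permutation $\pi$ output by algorithm NG satisfies $$\max_{i\in[k]}\sum_{j=1}^m w^{(i)}_j\,\mathrm{cov}(f^{(i)}_j,\pi)\ \le\ \Bigl(4k\ln\tfrac1\epsilon+8k\Bigr)\cdot\mathrm{OPT}(I).$$
   Context: **SRMA (min-max submodular ranking for multiple agents).** An instance consists of a ground set $U=[n]$, $k$ agents $a_1,\dots,a_k$, and for each agent $a_i$, monotone submodular functions $f^{(i)}_1,\dots,f^{(i)}_m:2^{[n]}\to[0,1]$ with $f^{(i)}_j(U)=1$ and weights $w^{(i)}_j>0$. For a permutation $\pi$ of $U$, the cover time $\mathrm{cov}(f,\pi)$ is the smallest index $t\in\{1,\dots,n\}$ such that $f$ has value $1$ on the set of the first $t$ elements of $\pi$. The objective value of $\pi$ is $\max_{i\in[k]}\sum_{j=1}^m w^{(i)}_j\mathrm{cov}(f^{(i)}_j,\pi)$; $\mathrm{OPT}(I)$ is its minimum over all permutations. $\epsilon>0$ is the minimum non-zero marginal value: for all $S\subseteq S'$ and all $i,j$, $f^{(i)}_j(S')>f^{(i)}_j(S)$ implies $f^{(i)}_j(S')-f^{(i)}_j(S)\ge\epsilon$. **Algorithm NG (normalized greedy).** View all $m\cdot k$ functions as one single collection. Select elements one at a time: if $S$ is the set of elements chosen so far and $\mathcal F$ is the set of functions $f$ (among all agents) with $f(S)<1$, choose next an element $e\in U\setminus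 S$ maximizing $\sum_{f\in\mathcal F} w_f\cdot\frac{f(S\cup\{e\})-f(S)}{1-f(S)}$, where $w_f$ is the weight of $f$. The order of selection is the output permutation (elements remaining after all functions are covered are appended arbitrarily). -}

module Defs where

open import Algebra.Apartness.Bundles using (HeytingCommutativeRing; HeytingField)
open import Algebra.Bundles using (CommutativeRing; Semiring)
open import Data.Bool.Base using (true)
open import Data.Fin.Base using (Fin; zero; suc; toℕ)
import Data.Fin.Base as Fin
open import Data.Fin.Permutation
  using (Permutation′; _⟨$⟩ʳ_; _⟨$⟩ˡ_; insert; remove; insert-remove)
import Data.Fin.Permutation as Perm
open import Data.Fin.Properties using (toℕ<n; toℕ-fromℕ<)
open import Data.Fin.Subset using (Subset; ⊤; ⁅_⁆; _∪_; _∩_; _⊆_; _∉_)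
open import Data.Fin.Subset.Properties using (⊆⊤)
open import Data.Nat.Base as ℕ using (ℕ; zero; suc; NonZero; z≤n; s≤s)
import Data.Nat.Properties as ℕₚ
open import Data.Product.Base using (∃; ∃-syntax; _×_; _,_; proj₁; proj₂)
open import Data.Sum.Base using (_⊎_; inj₁; inj₂; [_,_]′; map₂)
open import Data.Vec.Base using (_∷_; tabulate; replicate)
open import Data.Vec.Properties using (tabulate-cong)
open import Function.Base using (_∘_)
open import Level using (Level; _⊔_) renaming (suc to lsuc)
open import Relation.Binary.Core using (Rel)
open import Relation.Binary.Lattice.Definitions using (Supremum; Infimum)
open import Relation.Binary.PropositionalEquality.Core as ≡ using (_≡_)
open import Relation.Binary.Structures using (IsStrictPartialOrder)
open import Relation.Nullary.Decidable.Core using (Dec; yes; no; does)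
open import Relation.Nullary.Decidable using (dec-true)
open import Relation.Nullary.Negation.Core using (¬_; contradiction)

record OrderedField (c ℓ₁ ℓ₂ : Level) : Set (lsuc (c ⊔ ℓ₁ ⊔ ℓ₂)) where
  infix  4 _<_ _≤_
  infixl 6 _∨_ _∧_
  field
    heytingField : HeytingField c ℓ₁ ℓ₂

  open HeytingField heytingField public

  field
    _<_                    : Rel Carrier ℓ₂
    <-isStrictPartialOrder : IsStrictPartialOrder _≈_ _<_
    #⇒<⊎>                  : ∀ {x y} → x # y → x < y ⊎ y < x
    <⇒#                    : ∀ {x y} → x < y → x # y
    0<1                    : 0# < 1#
    +-monoˡ-<              : ∀ {x y} z → x < y → x + z < y + z
    *-pos                  : ∀ {x y} → 0# < x → 0# < y → 0# < x * y

  open IsStrictPartialOrder <-isStrictPartialOrder public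
    using (<-resp-≈; <-respˡ-≈; <-respʳ-≈)
    renaming (irrefl to <-irrefl; trans to <-trans; asym to <-asym)

  _≤_ : Rel Carrier ℓ₂
  x ≤ y = ¬ (y < x)

  field
    _∨_        : Carrier → Carrier → Carrier
    _∧_        : Carrier → Carrier → Carrier
    ∨-supremum : Supremum _≤_ _∨_
    ∧-infimum  : Infimum _≤_ _∧_

  commutativeRing : CommutativeRing c ℓ₁
  commutativeRing = HeytingCommutativeRing.commutativeRing heytingCommutativeRing

  open import Algebra.Definitions.RawSemiring
    (Semiring.rawSemiring (CommutativeRing.semiring commutativeRing)) public
    using (sum; _^_) renaming (_×_ to _×ₙ_)

  fromℕ : ℕ → Carrier
  fromℕ n = n ×ₙ 1#

  -- |x - y| < δ
  Close : Carrier → Carrier → Carrier → Set ℓ₂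
  Close δ x y = (x - y < δ) × (y - x < δ)

  ConvergesTo : (ℕ → Carrier) → Carrier → Set (c ⊔ ℓ₂)
  ConvergesTo s l =
    ∀ δ → 0# < δ → ∃[ N ] ∀ n → N ℕ.≤ n → Close δ (s n) l

  Cauchy : (ℕ → Carrier) → Set (c ⊔ ℓ₂)
  Cauchy s =
    ∀ δ → 0# < δ → ∃[ N ] ∀ m n → N ℕ.≤ m → N ℕ.≤ n → Close δ (s m) (s n)

-- The real numbers as an Archimedean, Cauchy-complete ordered field.  The
-- axioms are the constructive ones (the order is not assumed decidable, and
-- binary maxima and minima are primitive); in the presence of excluded middle
-- they characterise ℝ up to isomorphism.

record RealNumbers (c ℓ₁ ℓ₂ : Level) : Set (lsuc (c ⊔ ℓ₁ ⊔ ℓ₂)) where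
  field
    orderedField : OrderedField c ℓ₁ ℓ₂

  open OrderedField orderedField public

  field
    archimedean : ∀ x → ∃[ n ] x < fromℕ n
    complete    : ∀ s → Cauchy s → ∃[ l ] ConvergesTo s l

module _ {c ℓ₁ ℓ₂ : Level} (ℝ : RealNumbers c ℓ₁ ℓ₂) where
  open RealNumbers ℝ hiding (zero)

  <-cotrans : ∀ {x y} → x < y → ∀ z → x < z ⊎ z < y
  <-cotrans x<y z with #-cotrans (<⇒# x<y) z
  ... | inj₁ x#z = map₂ (λ z<x → <-trans z<x x<y) (#⇒<⊎> x#z)
  ... | inj₂ z#y =
    [ inj₂ , (λ y<z → inj₁ (<-trans x<y y<z)) ]′ (#⇒<⊎> z#y)

  ≤-antisym : ∀ {x y} → x ≤ y → y ≤ x → x ≈ y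
  ≤-antisym {x} {y} x≤y y≤x =
    proj₁ (tight x y) λ x#y → [ y≤x , x≤y ]′ (#⇒<⊎> x#y)

  ≤-trans : ∀ {x y z} → x ≤ y → y ≤ z → x ≤ z
  ≤-trans {y = y} x≤y y≤z z<x = [ y≤z , x≤y ]′ (<-cotrans z<x y)

  private
    [x-y]+y≈x : ∀ x y → (x - y) + y ≈ x
    [x-y]+y≈x x y =
      trans (+-assoc x (- y) y) (trans (+-cong refl (-‿inverseˡ y)) (+-identityʳ x))

    [x+y]-y≈x : ∀ x y → (x + y) - y ≈ x
    [x+y]-y≈x x y =
      trans (+-assoc x y (- y)) (trans (+-cong refl (-‿inverseʳ y)) (+-identityʳ x))

  -- The field gives an inverse of x - 0#, which is one of x.
  recip : ∀ x → 0# < x → Carrier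
  recip x 0<x = proj₁ (#⇒invertible (#-sym (<⇒# 0<x)))

  x<y⇒0<y-x : ∀ {x y} → x < y → 0# < y - x
  x<y⇒0<y-x {x} x<y = <-respˡ-≈ (-‿inverseʳ x) (+-monoˡ-< (- x) x<y)

  0<fromℕ[1+n] : ∀ n → 0# < fromℕ (suc n)
  0<fromℕ[1+n] zero    = <-respʳ-≈ (sym (+-identityʳ 1#)) 0<1
  0<fromℕ[1+n] (suc n) = <-trans (0<fromℕ[1+n] n)
    (<-respˡ-≈ (+-identityˡ _) (+-monoˡ-< (fromℕ (suc n)) 0<1))

  -- y = exp x, by Euler's limit exp x = lim (1 + x/n)ⁿ.
  IsExp : Carrier → Carrier → Set (c ⊔ ℓ₂)
  IsExp x y = ConvergesTo
    (λ n → (1# + x * recip (fromℕ (suc n)) (0<fromℕ[1+n] n)) ^ suc n) y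

  -- ℓ = ln x.
  IsLn : Carrier → Carrier → Set (c ⊔ ℓ₂)
  IsLn x ℓ = IsExp ℓ x

  ⋁ : ∀ {k} .{{_ : NonZero k}} → (Fin k → Carrier) → Carrier
  ⋁ {suc zero}    g = g zero
  ⋁ {suc (suc k)} g = g zero ∨ ⋁ (g ∘ suc)

  ⋀ : ∀ {k} .{{_ : NonZero k}} → (Fin k → Carrier) → Carrier
  ⋀ {suc zero}    g = g zero
  ⋀ {suc (suc k)} g = g zero ∧ ⋀ (g ∘ suc)

  -- Minimum over all permutations of Fin n.  A permutation of Fin (suc n) is
  -- the image j of zero together with a permutation of the remaining n points;
  -- minPerm-≤ and minPerm-glb below confirm that none is missed.
  minPerm : ∀ n → (Permutation′ n → Carrier) → Carrier
  minPerm zero    g = g Perm.id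
  minPerm (suc n) g = ⋀ λ j → minPerm n (λ σ → g (insert zero j σ))

  ⋀-≤ : ∀ {k} .{{_ : NonZero k}} (g : Fin k → Carrier) i → ⋀ g ≤ g i
  ⋀-≤ {suc zero}    g zero    = <-irrefl refl
  ⋀-≤ {suc (suc k)} g zero    = proj₁ (∧-infimum _ _)
  ⋀-≤ {suc (suc k)} g (suc i) =
    ≤-trans (proj₁ (proj₂ (∧-infimum _ _))) (⋀-≤ (g ∘ suc) i)

  ⋀-glb : ∀ {k} .{{_ : NonZero k}} (g : Fin k → Carrier) {b} →
          (∀ i → b ≤ g i) → b ≤ ⋀ g
  ⋀-glb {suc zero}    g b≤ = b≤ zero
  ⋀-glb {suc (suc k)} g b≤ =
    proj₂ (proj₂ (∧-infimum _ _)) _ (b≤ zero) (⋀-glb (g ∘ suc) (b≤ ∘ suc))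

  minPerm-glb : ∀ n (g : Permutation′ n → Carrier) {b} →
                (∀ σ → b ≤ g σ) → b ≤ minPerm n g
  minPerm-glb zero    g b≤ = b≤ Perm.id
  minPerm-glb (suc n) g b≤ =
    ⋀-glb (λ j → minPerm n (λ σ → g (insert zero j σ)))
      (λ j → minPerm-glb n _ (λ σ → b≤ (insert zero j σ)))

  -- Permutations are only compared pointwise, so g must respect that equality.
  minPerm-≤ : ∀ n (g : Permutation′ n → Carrier) →
              (∀ {σ τ} → σ Perm.≈ τ → g σ ≤ g τ) →
              ∀ σ → minPerm n g ≤ g σ
  minPerm-≤ zero    g resp σ = resp λ ()
  minPerm-≤ (suc n) g resp σ =
    ≤-trans (⋀-≤ (λ j → minPerm n (λ τ → g (insert zero j τ))) (σ ⟨$⟩ʳ zero))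
    (≤-trans (minPerm-≤ n (λ τ → g (insert zero (σ ⟨$⟩ʳ zero) τ))
               (λ τ≈τ′ → resp (insert-cong τ≈τ′)) (remove zero σ))
             (resp (insert-remove zero σ)))
    where
    insert-cong : ∀ {j} {τ τ′ : Permutation′ n} → τ Perm.≈ τ′ →
                  insert zero j τ Perm.≈ insert zero j τ′
    insert-cong τ≈τ′ zero    = ≡.refl
    insert-cong {j} τ≈τ′ (suc p) = ≡.cong (Fin.punchIn j) (τ≈τ′ p)

  -- n elements, k agents, m functions per agent.
  record SRMA (n k m : ℕ) : Set (c ⊔ ℓ₁ ⊔ ℓ₂) where
    field
      f          : Fin k → Fin m → Subset n → Carrier
      f-nonneg   : ∀ i j S → 0# ≤ f i j S
      f-≤1       : ∀ i j S → f i j S ≤ 1#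
      monotone   : ∀ i j {S T} → S ⊆ T → f i j S ≤ f i j T
      submodular : ∀ i j S T →
                   f i j (S ∪ T) + f i j (S ∩ T) ≤ f i j S + f i j T
      f-⊤        : ∀ i j → f i j ⊤ ≈ 1#
      w          : Fin k → Fin m → Carrier
      w-pos      : ∀ i j → 0# < w i j
      ε          : Carrier
      ε-pos      : 0# < ε
      ε-lower    : ∀ i j {S T} → S ⊆ T → f i j S < f i j T →
                   ε ≤ f i j T - f i j S
      ε-attained : ∃[ i ] ∃[ j ] ∃[ S ] ∃[ T ]
                   S ⊆ T × f i j S < f i j T × f i j T - f i j S ≈ ε

    -- Decidability of "f has value 1 on S" comes from the gap ε.
    covered : ∀ i j S → f i j S ≈ 1# ⊎ f i j S < 1#
    covered i j S with <-cotrans 1-ε<1 (f i j S)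
      where
      1-ε<1 : 1# - ε < 1#
      1-ε<1 = <-respˡ-≈ (+-identityˡ _)
        (<-respʳ-≈ (trans (+-cong refl (+-comm 1# (- ε)))
                   (trans (sym (+-assoc ε (- ε) 1#))
                   (trans (+-cong (-‿inverseʳ ε) refl) (+-identityˡ 1#))))
                   (+-monoˡ-< (1# - ε) ε-pos))
    ... | inj₂ f<1   = inj₂ f<1
    ... | inj₁ 1-ε<f = inj₁ (≤-antisym (f-≤1 i j S) λ f<1 →
          ε-lower i j ⊆⊤ (<-respʳ-≈ (sym (f-⊤ i j)) f<1)
            (<-respˡ-≈ (+-cong (sym (f-⊤ i j)) refl) 1-f<ε))
      where
      1-f<ε : 1# - f i j S < ε
      1-f<ε = <-respʳ-≈ ([x+y]-y≈x ε (f i j S))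
        (+-monoˡ-< (- f i j S)
          (<-respʳ-≈ (+-comm (f i j S) ε)
            (<-respˡ-≈ ([x-y]+y≈x 1# ε) (+-monoˡ-< ε 1-ε<f))))

    covered? : ∀ i j S → Dec (f i j S ≈ 1#)
    covered? i j S with covered i j S
    ... | inj₁ f≈1 = yes f≈1
    ... | inj₂ f<1 = no λ f≈1 → <-irrefl f≈1 f<1

-- The first t elements of π, where π ⟨$⟩ʳ p is the element in (0-based)
-- position p.
prefix : ∀ {n} → Permutation′ n → ℕ → Subset n
prefix π t = tabulate λ e → does (toℕ (π ⟨$⟩ˡ e) ℕₚ.<? t)

prefix-full : ∀ {n} (π : Permutation′ n) → prefix π n ≡ ⊤
prefix-full {n} π = ≡.trans
  (tabulate-cong λ e → dec-true (toℕ (π ⟨$⟩ˡ e) ℕₚ.<? n) (toℕ<n (π ⟨$⟩ˡ e)))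
  (tabulate-true n)
  where
  tabulate-true : ∀ n → tabulate {n = n} (λ _ → true) ≡ replicate n true
  tabulate-true zero    = ≡.refl
  tabulate-true (suc n) = ≡.cong (true ∷_) (tabulate-true n)

least : ∀ {a n} {P : Fin n → Set a} → (∀ p → Dec (P p)) → ∃ P →
        ∃[ p ] P p × (∀ q → q Fin.< p → ¬ P q)
least {n = suc n} P? (p , Pp) with P? zero
... | yes P0 = zero , P0 , λ _ ()
... | no ¬P0 with p
...   | zero   = contradiction Pp ¬P0
...   | suc p′ with least (P? ∘ suc) (p′ , Pp)
...     | r , Pr , min = suc r , Pr , λ where
            zero    _         → ¬P0
            (suc q) (s≤s q<r) → min q q<r

module _ {c ℓ₁ ℓ₂ : Level} (ℝ : RealNumbers c ℓ₁ ℓ₂) where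
  open RealNumbers ℝ hiding (zero)

  module _ {n k m : ℕ} .{{_ : NonZero n}} .{{_ : NonZero k}} (I : SRMA ℝ n k m) where
    open SRMA I

    coverPosition : ∀ i j (π : Permutation′ n) →
      ∃[ p ] f i j (prefix π (suc (toℕ p))) ≈ 1# ×
             (∀ q → q Fin.< p → ¬ (f i j (prefix π (suc (toℕ q))) ≈ 1#))
    coverPosition i j π =
      least (λ p → covered? i j (prefix π (suc (toℕ p)))) (last , f-last)
      where
      last : Fin n
      last = Fin.fromℕ< (ℕₚ.≤-reflexive (ℕₚ.suc-pred n))
      prefix-last : prefix π (suc (toℕ last)) ≡ ⊤
      prefix-last = ≡.trans
        (≡.cong (prefix π)
          (≡.trans (≡.cong suc (toℕ-fromℕ< _)) (ℕₚ.suc-pred n)))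
        (prefix-full π)
      f-last : f i j (prefix π (suc (toℕ last))) ≈ 1#
      f-last = trans (reflexive (≡.cong (f i j) prefix-last)) (f-⊤ i j)

    cov : Fin k → Fin m → Permutation′ n → ℕ
    cov i j π = suc (toℕ (proj₁ (coverPosition i j π)))

    agentCost : Permutation′ n → Fin k → Carrier
    agentCost π i = sum λ j → w i j * fromℕ (cov i j π)

    objective : Permutation′ n → Carrier
    objective π = ⋁ ℝ (agentCost π)

    OPT : Carrier
    OPT = minPerm ℝ n objective

    score : Subset n → Fin n → Carrier
    score S e = sum λ i → sum λ j →
      [ (λ _   → 0#)
      , (λ f<1 → w i j * ((f i j (S ∪ ⁅ e ⁆) - f i j S)
                          * recip ℝ (1# - f i j S) (x<y⇒0<y-x ℝ f<1)))
      ]′ (covered i j S)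

    -- π is a possible output of the normalized greedy algorithm, for some way
    -- of breaking ties.  Once every function is covered all scores are 0, so
    -- the remaining elements may come in any order.
    NormalizedGreedy : Permutation′ n → Set ℓ₂
    NormalizedGreedy π = ∀ (p : Fin n) e → e ∉ prefix π (toℕ p) →
      score (prefix π (toℕ p)) e ≤ score (prefix π (toℕ p)) (π ⟨$⟩ʳ p)

{-# OPTIONS --safe #-}

-- Summed over all agents, the cost of greedy π is compared with that of an
-- arbitrary permutation σ; passing between the sum and the maximum over agents
-- costs the factor k.  Let R t and Q t be the weights of the functions left
-- uncovered by the first t elements of π and of σ, and P t the score of greedy
-- step t.  Up to functions covered by ∅, costs are Σ R and Σ Q.  By
-- submodularity some element among the first s of σ has score at least
-- (R t - Q s) / s, so R t ≤ s P t + Q s.  Conversely one function contributes to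
-- the scores at most w (1 + ln (1/ε)), since Σ (1 - y′/y) ≤ ln (1/ε) as long as
-- its residual y = 1 - f(S) stays positive, hence at least ε; so
-- P t + P (t + 1) + ⋯ ≤ (1 + ln (1/ε)) R t.  Halving both coordinates of
-- the histogram of R gives Σ R ≤ 4 (1 + ln (1/ε)) Σ Q.

module Submission where

open import Defs
open import Data.Nat.Base using (ℕ; NonZero)
import Data.Nat.Base as ℕ
open import Data.Fin.Permutation using (Permutation′)

open import Algebra.Bundles using (CommutativeRing)
open import Data.Bool.Base using (true)
open import Data.Fin.Base using (Fin; zero; suc; toℕ; fromℕ<)
open import Data.Fin.Permutation using (_⟨$⟩ʳ_; _⟨$⟩ˡ_; inverseˡ; inverseʳ)
open import Data.Fin.Properties using (toℕ-fromℕ<; toℕ-injective; toℕ<n)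
open import Data.Fin.Subset using (Subset; ⊤; ⁅_⁆; _∪_; _∩_; _⊆_; _∈_)
open import Data.Fin.Subset.Properties
  using (⊆⊤; p⊆p∪q; q⊆p∪q; x∈p∪q⁻; x∈p∪q⁺; x∈p∩q⁺; x∈⁅x⁆; x∈⁅y⁆⇒x≡y; _∈?_)
import Data.Nat.Properties as ℕₚ
open import Data.Product.Base using (∃-syntax; _×_; _,_; proj₁; proj₂)
open import Data.Sum.Base using (_⊎_; inj₁; inj₂; [_,_]′; map₂)
open import Data.Vec.Properties using ([]=⇒lookup; lookup⇒[]=; lookup∘tabulate)
open import Function.Base using (_∘_)
open import Level using (Level; _⊔_)
open import Relation.Binary.Bundles using (Poset)
open import Relation.Binary.PropositionalEquality.Core as ≡ using (_≡_)
import Relation.Binary.Reasoning.PartialOrder as PartialOrderReasoning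
open import Relation.Nullary.Decidable using (Dec; yes; no; does; dec-true)
open import Relation.Nullary.Negation.Core using (¬_; contradiction)

-- Ring solver for a commutative ring, with coefficients in ℤ.

module IntegerCoefficients {c ℓ} (R : CommutativeRing c ℓ) where
  open CommutativeRing R
  open import Algebra.Properties.Ring ring
  open import Algebra.Properties.AbelianGroup +-abelianGroup using (⁻¹-∙-comm)
  open import Algebra.Properties.Semiring.Mult.TCOptimised semiring renaming (_×_ to _·_)
  open import Algebra.Solver.Ring.AlmostCommutativeRing
  open import Data.Integer.Base as ℤ using (ℤ; +_; -[1+_]; _⊖_; _◃_)
  open import Data.Integer.Properties using ([1+m]⊖[1+n]≡m⊖n; +-*-commutativeRing; _≟_)
  open import Data.Maybe.Base using (Maybe; just; nothing)
  open import Data.Sign.Base as Sign using (Sign)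
  open import Relation.Binary.Reasoning.Setoid setoid

  ⟦_⟧ℤ : ℤ → Carrier
  ⟦ + n      ⟧ℤ = n · 1#
  ⟦ -[1+ n ] ⟧ℤ = - (ℕ.suc n · 1#)

  ⟦m⊖n⟧≈m-n : ∀ m n → ⟦ m ⊖ n ⟧ℤ ≈ m · 1# - n · 1#
  ⟦m⊖n⟧≈m-n m ℕ.zero = sym (trans (+-congˡ -0#≈0#) (+-identityʳ _))
  ⟦m⊖n⟧≈m-n ℕ.zero (ℕ.suc n) = sym (+-identityˡ _)
  ⟦m⊖n⟧≈m-n (ℕ.suc m) (ℕ.suc n) = begin
    ⟦ ℕ.suc m ⊖ ℕ.suc n ⟧ℤ          ≡⟨ ≡.cong ⟦_⟧ℤ ([1+m]⊖[1+n]≡m⊖n m n) ⟩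
    ⟦ m ⊖ n ⟧ℤ                      ≈⟨ ⟦m⊖n⟧≈m-n m n ⟩
    m · 1# - n · 1#                 ≈⟨ +-congˡ (+-identityˡ _) ⟨
    m · 1# + (0# - n · 1#)          ≈⟨ +-congˡ (+-congʳ (-‿inverseʳ 1#)) ⟨
    m · 1# + ((1# - 1#) - n · 1#)   ≈⟨ +-congˡ (+-assoc _ _ _) ⟩
    m · 1# + (1# + (- 1# - n · 1#)) ≈⟨ +-assoc _ _ _ ⟨
    m · 1# + 1# + (- 1# - n · 1#)   ≈⟨ +-cong (+-comm _ _) (⁻¹-∙-comm 1# (n · 1#)) ⟩
    1# + m · 1# - (1# + n · 1#)     ≈⟨ +-cong (×-homo-+ 1# 1 m) (-‿cong (×-homo-+ 1# 1 n)) ⟨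
    ℕ.suc m · 1# - ℕ.suc n · 1#     ∎

  +-homo : ∀ i j → ⟦ i ℤ.+ j ⟧ℤ ≈ ⟦ i ⟧ℤ + ⟦ j ⟧ℤ
  +-homo (+ m)    (+ n)    = ×-homo-+ 1# m n
  +-homo (+ m)    -[1+ n ] = ⟦m⊖n⟧≈m-n m (ℕ.suc n)
  +-homo -[1+ m ] (+ n)    = trans (⟦m⊖n⟧≈m-n n (ℕ.suc m)) (+-comm _ _)
  +-homo -[1+ m ] -[1+ n ] = begin
    - (ℕ.suc (ℕ.suc (m ℕ.+ n)) · 1#)   ≡⟨ ≡.cong (λ p → - (ℕ.suc p · 1#)) (≡.sym (+-suc m n)) ⟩
    - ((ℕ.suc m ℕ.+ ℕ.suc n) · 1#)     ≈⟨ -‿cong (×-homo-+ 1# (ℕ.suc m) (ℕ.suc n)) ⟩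
    - (ℕ.suc m · 1# + ℕ.suc n · 1#)    ≈⟨ ⁻¹-∙-comm _ _ ⟨
    - (ℕ.suc m · 1#) - (ℕ.suc n · 1#)  ∎
    where open import Data.Nat.Properties using (+-suc)

  ⟦-◃⟧ : ∀ n → ⟦ Sign.- ◃ n ⟧ℤ ≈ - (n · 1#)
  ⟦-◃⟧ ℕ.zero    = sym -0#≈0#
  ⟦-◃⟧ (ℕ.suc n) = refl

  ⟦+◃⟧ : ∀ n → ⟦ Sign.+ ◃ n ⟧ℤ ≈ n · 1#
  ⟦+◃⟧ ℕ.zero    = refl
  ⟦+◃⟧ (ℕ.suc n) = refl

  *-homo : ∀ i j → ⟦ i ℤ.* j ⟧ℤ ≈ ⟦ i ⟧ℤ * ⟦ j ⟧ℤ
  *-homo (+ m)    (+ n)    = trans (⟦+◃⟧ (m ℕ.* n)) (×1-homo-* m n)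
  *-homo (+ m)    -[1+ n ] = trans (⟦-◃⟧ (m ℕ.* ℕ.suc n))
    (trans (-‿cong (×1-homo-* m (ℕ.suc n))) (-‿distribʳ-* _ _))
  *-homo -[1+ m ] (+ n)    = trans (⟦-◃⟧ (ℕ.suc m ℕ.* n))
    (trans (-‿cong (×1-homo-* (ℕ.suc m) n)) (-‿distribˡ-* _ _))
  *-homo -[1+ m ] -[1+ n ] = begin
    ⟦ Sign.+ ◃ (ℕ.suc m ℕ.* ℕ.suc n) ⟧ℤ      ≈⟨ ⟦+◃⟧ (ℕ.suc m ℕ.* ℕ.suc n) ⟩
    (ℕ.suc m ℕ.* ℕ.suc n) · 1#               ≈⟨ ×1-homo-* (ℕ.suc m) (ℕ.suc n) ⟩
    (ℕ.suc m · 1#) * (ℕ.suc n · 1#)          ≈⟨ -‿involutive _ ⟨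
    - - ((ℕ.suc m · 1#) * (ℕ.suc n · 1#))    ≈⟨ -‿cong (-‿distribʳ-* _ _) ⟩
    - ((ℕ.suc m · 1#) * - (ℕ.suc n · 1#))    ≈⟨ -‿distribˡ-* _ _ ⟩
    - (ℕ.suc m · 1#) * - (ℕ.suc n · 1#)      ∎

  -‿homo : ∀ i → ⟦ ℤ.- i ⟧ℤ ≈ - ⟦ i ⟧ℤ
  -‿homo (+ ℕ.zero)    = sym -0#≈0#
  -‿homo (+ (ℕ.suc n)) = refl
  -‿homo -[1+ n ]      = sym (-‿involutive _)

  morphism : CommutativeRing.rawRing +-*-commutativeRing
             -Raw-AlmostCommutative⟶ fromCommutativeRing R
  morphism = record
    { ⟦_⟧    = ⟦_⟧ℤ
    ; +-homo = +-homo
    ; *-homo = *-homo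
    ; -‿homo = -‿homo
    ; 0-homo = refl
    ; 1-homo = refl
    }

  -- Equality in the ring itself is not decidable. Equal integers have equal images, and this is
  -- what lets the solver cancel coefficients.
  _coeff≟_ : ∀ i j → Maybe (⟦ i ⟧ℤ ≈ ⟦ j ⟧ℤ)
  i coeff≟ j with i ≟ j
  ... | yes i≡j = just (reflexive (≡.cong ⟦_⟧ℤ i≡j))
  ... | no  _   = nothing

  open import Algebra.Solver.Ring _ _ morphism _coeff≟_ public
    using (Polynomial; con; solve; _:=_; _:+_; _:*_; _:-_)

  :0 :1 : ∀ {n} → Polynomial n
  :0 = con (+ 0)
  :1 = con (+ 1)

-- Order and arithmetic in the constructive ordered field.

module RealProperties {c ℓ₁ ℓ₂ : Level} (ℝ : RealNumbers c ℓ₁ ℓ₂) where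
  open RealNumbers ℝ hiding (zero)
  open CommutativeRing commutativeRing using (semiring; commutativeSemiring)
  open IntegerCoefficients commutativeRing public
    using (solve; _:=_; _:+_; _:*_; _:-_; :0; :1)
  open import Algebra.Properties.Semiring.Sum semiring public
    using (sum-cong-≋; sum-replicate-zero; ∑-distrib-+; *-distribˡ-sum)
  open import Algebra.Properties.Semiring.Mult semiring public
    using (×1-homo-*)
  open import Algebra.Properties.CommutativeSemiring.Exp commutativeSemiring public
    using (^-congˡ; ^-distrib-*)

  <⇒≤ : ∀ {x y} → x < y → x ≤ y
  <⇒≤ x<y y<x = <-asym x<y y<x

  ≤-reflexive : ∀ {x y} → x ≈ y → x ≤ y
  ≤-reflexive x≈y = <-irrefl (sym x≈y)

  ≤-refl : ∀ {x} → x ≤ x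
  ≤-refl = ≤-reflexive refl

  poset : Poset c ℓ₁ ℓ₂
  poset = record
    { _≤_ = _≤_
    ; isPartialOrder = record
      { isPreorder = record
        { isEquivalence = isEquivalence
        ; reflexive     = ≤-reflexive
        ; trans         = ≤-trans ℝ
        }
      ; antisym = ≤-antisym ℝ
      }
    }

  module ≤-Reasoning = PartialOrderReasoning poset

  -- The order is not decidable, but `_≤_` is a negation, so a case split is available when the goal
  -- has the form `a ≤ b`: given `b < a`, the second branch refutes `y < x`, which is `x ≤ y`, and
  -- the first branch then gives the contradiction.
  by-cases : ∀ x y {a b} → (x ≤ y → a ≤ b) → (y ≤ x → a ≤ b) → a ≤ b
  by-cases x y x≤y⇒ y≤x⇒ b<a =
    x≤y⇒ (λ y<x → y≤x⇒ (<⇒≤ y<x) b<a) b<a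

  ≤-<-trans : ∀ {x y z} → x ≤ y → y < z → x < z
  ≤-<-trans {x} x≤y y<z = [ (λ y<x → contradiction y<x x≤y) , (λ x<z → x<z) ]′ (<-cotrans ℝ y<z x)

  <-≤-trans : ∀ {x y z} → x < y → y ≤ z → x < z
  <-≤-trans {z = z} x<y y≤z = [ (λ x<z → x<z) , (λ z<y → contradiction z<y y≤z) ]′ (<-cotrans ℝ x<y z)

  +-monoˡ-≤ : ∀ {x y} z → x ≤ y → x + z ≤ y + z
  +-monoˡ-≤ {x} {y} z x≤y y+z<x+z =
    x≤y (<-respˡ-≈ (cancel y z) (<-respʳ-≈ (cancel x z) (+-monoˡ-< (- z) y+z<x+z)))
    where
    cancel : ∀ x z → x + z - z ≈ x
    cancel = solve 2 (λ x z → x :+ z :- z := x) refl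

  +-monoʳ-≤ : ∀ {x y} z → x ≤ y → z + x ≤ z + y
  +-monoʳ-≤ {x} {y} z x≤y = begin
    z + x ≈⟨ +-comm z x ⟩
    x + z ≤⟨ +-monoˡ-≤ z x≤y ⟩
    y + z ≈⟨ +-comm y z ⟩
    z + y ∎
    where open ≤-Reasoning

  +-mono-≤ : ∀ {x y u v} → x ≤ y → u ≤ v → x + u ≤ y + v
  +-mono-≤ {y = y} {u} x≤y u≤v = ≤-trans ℝ (+-monoˡ-≤ u x≤y) (+-monoʳ-≤ y u≤v)

  +-nonneg : ∀ {x y} → 0# ≤ x → 0# ≤ y → 0# ≤ x + y
  +-nonneg 0≤x 0≤y = ≤-trans ℝ (≤-reflexive (sym (+-identityˡ 0#))) (+-mono-≤ 0≤x 0≤y)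

  x≤y⇒0≤y-x : ∀ {x y} → x ≤ y → 0# ≤ y - x
  x≤y⇒0≤y-x {x} x≤y = ≤-trans ℝ (≤-reflexive (sym (-‿inverseʳ x))) (+-monoˡ-≤ (- x) x≤y)

  0≤y-x⇒x≤y : ∀ {x y} → 0# ≤ y - x → x ≤ y
  0≤y-x⇒x≤y {x} 0≤y-x y<x = 0≤y-x (<-respʳ-≈ (-‿inverseʳ x) (+-monoˡ-< (- x) y<x))

  0<y-x⇒x<y : ∀ {x y} → 0# < y - x → x < y
  0<y-x⇒x<y {x} {y} 0<y-x = <-respˡ-≈ (+-identityˡ x)
    (<-respʳ-≈ (solve 2 (λ x y → y :- x :+ x := y) refl x y) (+-monoˡ-< x 0<y-x))

  -- Reduces an inequality to a ring identity: the difference is exhibited as an expression that is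
  -- visibly nonnegative, and the solver checks the rest.
  ≤-by : ∀ {x y} d → 0# ≤ d → y - x ≈ d → x ≤ y
  ≤-by d 0≤d y-x≈d = 0≤y-x⇒x≤y (≤-trans ℝ 0≤d (≤-reflexive (sym y-x≈d)))

  -- The goal is a negation, so both factors may be assumed positive: a nonnegative factor that is
  -- not positive equals 0, and then so does the product.
  *-nonneg : ∀ {x y} → 0# ≤ x → 0# ≤ y → 0# ≤ x * y
  *-nonneg {x} {y} 0≤x 0≤y xy<0 = ¬0<x λ 0<x → ¬0<y λ 0<y → <-asym xy<0 (*-pos 0<x 0<y)
    where
    ¬0<x : ¬ (¬ (0# < x))
    ¬0<x x≤0 = <-irrefl (trans (*-congʳ (≤-antisym ℝ x≤0 0≤x)) (zeroˡ y)) xy<0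
    ¬0<y : ¬ (¬ (0# < y))
    ¬0<y y≤0 = <-irrefl (trans (*-congˡ (≤-antisym ℝ y≤0 0≤y)) (zeroʳ x)) xy<0

  *-monoʳ-≤ : ∀ {z x y} → 0# ≤ z → x ≤ y → z * x ≤ z * y
  *-monoʳ-≤ {z} {x} {y} 0≤z x≤y = ≤-by (z * (y - x)) (*-nonneg 0≤z (x≤y⇒0≤y-x x≤y))
    (solve 3 (λ x y z → z :* y :- z :* x := z :* (y :- x)) refl x y z)

  *-monoˡ-≤ : ∀ {z x y} → 0# ≤ z → x ≤ y → x * z ≤ y * z
  *-monoˡ-≤ {z} {x} {y} 0≤z x≤y = begin
    x * z ≈⟨ *-comm x z ⟩
    z * x ≤⟨ *-monoʳ-≤ 0≤z x≤y ⟩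
    z * y ≈⟨ *-comm z y ⟩
    y * z ∎
    where open ≤-Reasoning

  *-mono-≤ : ∀ {x y u v} → 0# ≤ y → 0# ≤ u → x ≤ y → u ≤ v → x * u ≤ y * v
  *-mono-≤ 0≤y 0≤u x≤y u≤v = ≤-trans ℝ (*-monoˡ-≤ 0≤u x≤y) (*-monoʳ-≤ 0≤y u≤v)

  *-cancelʳ-≤ : ∀ {z x y} → 0# < z → x * z ≤ y * z → x ≤ y
  *-cancelʳ-≤ {z} {x} {y} 0<z xz≤yz y<x = xz≤yz (0<y-x⇒x<y
    (<-respʳ-≈ (solve 3 (λ x y z → (x :- y) :* z := x :* z :- y :* z) refl x y z)
      (*-pos (x<y⇒0<y-x ℝ y<x) 0<z)))

  recip-inverseʳ : ∀ x (0<x : 0# < x) → x * recip ℝ x 0<x ≈ 1#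
  recip-inverseʳ x 0<x = trans (*-congʳ (solve 1 (λ x → x := x :- :0) refl x))
    (proj₂ (proj₂ (#⇒invertible (#-sym (<⇒# 0<x)))))

  -- An invertible element is apart from 0 and hence has a sign. A negative reciprocal r would make
  -- -(x r) = -1 positive.
  0<recip : ∀ x (0<x : 0# < x) → 0# < recip ℝ x 0<x
  0<recip x 0<x = [ (λ r<0 → contradiction (neg r<0) (<-asym 0<1)) , (λ 0<r → 0<r) ]′
    (#⇒<⊎> (invertible⇒# (x , xr≈1 , trans (*-comm _ _) xr≈1)))
    where
    r = recip ℝ x 0<x
    xr≈1 : x * (r - 0#) ≈ 1#
    xr≈1 = trans (*-congˡ (solve 1 (λ x → x :- :0 := x) refl r)) (recip-inverseʳ x 0<x)
    neg : r < 0# → 1# < 0#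
    neg r<0 = 0<y-x⇒x<y (<-respʳ-≈
      (trans (solve 2 (λ x r → x :* (:0 :- r) := :0 :- x :* r) refl x r)
             (+-congˡ (-‿cong (recip-inverseʳ x 0<x))))
      (*-pos 0<x (x<y⇒0<y-x ℝ r<0)))

  0≤1 : 0# ≤ 1#
  0≤1 = <⇒≤ 0<1

  0≤fromℕ : ∀ n → 0# ≤ fromℕ n
  0≤fromℕ ℕ.zero    = ≤-refl
  0≤fromℕ (ℕ.suc n) = +-nonneg 0≤1 (0≤fromℕ n)

  fromℕ-mono-≤ : ∀ {m n} → m ℕ.≤ n → fromℕ m ≤ fromℕ n
  fromℕ-mono-≤ {n = n} ℕ.z≤n = 0≤fromℕ n
  fromℕ-mono-≤ (ℕ.s≤s m≤n)   = +-monoʳ-≤ 1# (fromℕ-mono-≤ m≤n)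

  ^-nonneg : ∀ {x} n → 0# ≤ x → 0# ≤ x ^ n
  ^-nonneg ℕ.zero    0≤x = 0≤1
  ^-nonneg (ℕ.suc n) 0≤x = *-nonneg 0≤x (^-nonneg n 0≤x)

  ^-mono-≤ : ∀ {x y} n → 0# ≤ x → x ≤ y → x ^ n ≤ y ^ n
  ^-mono-≤ ℕ.zero    0≤x x≤y = ≤-refl
  ^-mono-≤ (ℕ.suc n) 0≤x x≤y =
    *-mono-≤ (≤-trans ℝ 0≤x x≤y) (^-nonneg n 0≤x) x≤y (^-mono-≤ n 0≤x x≤y)

  1^n≈1 : ∀ n → 1# ^ n ≈ 1#
  1^n≈1 ℕ.zero    = refl
  1^n≈1 (ℕ.suc n) = trans (*-identityˡ _) (1^n≈1 n)

  -- The tangent to xⁿ at a lies below the graph; multiplied through by a to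
  -- avoid the exponent n - 1.
  power-tangent : ∀ {a b} n → 0# ≤ a → 0# ≤ b →
                  a ^ n * (a + fromℕ n * (b - a)) ≤ a * b ^ n
  power-tangent {a} {b} ℕ.zero 0≤a 0≤b = ≤-reflexive
    (solve 2 (λ a b → :1 :* (a :+ :0 :* (b :- a)) := a :* :1) refl a b)
  power-tangent {a} {b} (ℕ.suc n) 0≤a 0≤b = ≤-by
    -- The first summand is b times the gap of the induction hypothesis; the second is the square
    -- term that raising the degree leaves over.
    (b * (a * b ^ n - a ^ n * (a + fromℕ n * (b - a))) + a ^ n * (fromℕ n * ((b - a) * (b - a))))
    (+-nonneg (*-nonneg 0≤b (x≤y⇒0≤y-x (power-tangent n 0≤a 0≤b)))
      (*-nonneg (^-nonneg n 0≤a) (*-nonneg (0≤fromℕ n) (square-nonneg (b - a)))))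
    (solve 5 (λ a b p q n →
       a :* (b :* q) :- (a :* p) :* (a :+ (:1 :+ n) :* (b :- a))
       := b :* (a :* q :- p :* (a :+ n :* (b :- a))) :+ p :* (n :* ((b :- a) :* (b :- a))))
      refl a b (a ^ n) (b ^ n) (fromℕ n))
    where
    square-nonneg : ∀ x → 0# ≤ x * x
    square-nonneg x = by-cases 0# x (λ 0≤x → *-nonneg 0≤x 0≤x) λ x≤0 →
      ≤-trans ℝ (*-nonneg (x≤y⇒0≤y-x x≤0) (x≤y⇒0≤y-x x≤0))
        (≤-reflexive (solve 1 (λ x → (:0 :- x) :* (:0 :- x) := x :* x) refl x))

  -- The tangent at 1. For b = 1 - u/n it bounds the n-th power below by 1 - u.
  bernoulli : ∀ {b} n → 0# ≤ b → 1# + fromℕ n * (b - 1#) ≤ b ^ n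
  bernoulli {b} n 0≤b = begin
    1# + fromℕ n * (b - 1#)            ≈⟨ *-identityˡ _ ⟨
    1# * (1# + fromℕ n * (b - 1#))     ≈⟨ *-congʳ (1^n≈1 n) ⟨
    1# ^ n * (1# + fromℕ n * (b - 1#)) ≤⟨ power-tangent n 0≤1 0≤b ⟩
    1# * b ^ n                         ≈⟨ *-identityˡ _ ⟩
    b ^ n                              ∎
    where open ≤-Reasoning

  sum-mono-≤ : ∀ {n} {f g : Fin n → Carrier} → (∀ i → f i ≤ g i) → sum f ≤ sum g
  sum-mono-≤ {ℕ.zero}  f≤g = ≤-refl
  sum-mono-≤ {ℕ.suc n} f≤g = +-mono-≤ (f≤g zero) (sum-mono-≤ (f≤g ∘ suc))

  sum-nonneg : ∀ {n} {f : Fin n → Carrier} → (∀ i → 0# ≤ f i) → 0# ≤ sum f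
  sum-nonneg {ℕ.zero}  0≤f = ≤-refl
  sum-nonneg {ℕ.suc n} 0≤f = +-nonneg (0≤f zero) (sum-nonneg (0≤f ∘ suc))

-- Bounds on the exponential and the logarithm through Euler's approximants.

module Logarithm {c ℓ₁ ℓ₂ : Level} (ℝ : RealNumbers c ℓ₁ ℓ₂) where
  open RealNumbers ℝ hiding (zero)
  open RealProperties ℝ

  1/[1+_] : ℕ → Carrier
  1/[1+ n ] = recip ℝ (fromℕ (ℕ.suc n)) (0<fromℕ[1+n] ℝ n)

  [1+n]*1/[1+n]≈1 : ∀ n → fromℕ (ℕ.suc n) * 1/[1+ n ] ≈ 1#
  [1+n]*1/[1+n]≈1 n = recip-inverseʳ _ (0<fromℕ[1+n] ℝ n)

  0≤1/[1+n] : ∀ n → 0# ≤ 1/[1+ n ]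
  0≤1/[1+n] n = <⇒≤ (0<recip _ (0<fromℕ[1+n] ℝ n))

  1/[1+n]≤1 : ∀ n → 1/[1+ n ] ≤ 1#
  1/[1+n]≤1 n = ≤-by (fromℕ n * 1/[1+ n ]) (*-nonneg (0≤fromℕ n) (0≤1/[1+n] n))
    (trans (+-congʳ (sym ([1+n]*1/[1+n]≈1 n)))
      (solve 2 (λ n r → (:1 :+ n) :* r :- r := n :* r) refl (fromℕ n) 1/[1+ n ]))

  -- Definitionally the sequence in `IsExp`, so `IsLn ℝ z ℓ` says that `euler ℓ` converges to z.
  euler : Carrier → ℕ → Carrier
  euler x n = (1# + x * 1/[1+ n ]) ^ ℕ.suc n

  -- a exp x ≤ b for a nonnegative exponent x.
  ExpBound : Carrier → Carrier → Carrier → Set ℓ₂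
  ExpBound x a b = (0# ≤ x) × (∀ n → a * euler x n ≤ b)

  ExpBound-zero : ∀ {a b} → a ≤ b → ExpBound 0# a b
  ExpBound-zero {a} {b} a≤b = ≤-refl , λ n → begin
    a * euler 0# n
      ≈⟨ *-congˡ (^-congˡ (ℕ.suc n) (solve 1 (λ r → :1 :+ :0 :* r := :1) refl 1/[1+ n ])) ⟩
    a * 1# ^ ℕ.suc n  ≈⟨ *-congˡ (1^n≈1 (ℕ.suc n)) ⟩
    a * 1#            ≈⟨ *-identityʳ a ⟩
    a                 ≤⟨ a≤b ⟩
    b                 ∎
    where open ≤-Reasoning

  -- exp u ≤ 1/(1 - u), in the form (1 - u) ≤ (1 - u/n)ⁿ.
  ExpBound-step : ∀ {x u a y z} → 0# ≤ a → 0# ≤ u → 0# < y → 0# < z → u * y ≈ y - z →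
                  ExpBound x a z → ExpBound (u + x) a y
  ExpBound-step {x} {u} {a} {y} {z} 0≤a 0≤u 0<y 0<z uy≈y-z (0≤x , bound) =
    0≤u+x , λ n → *-cancelʳ-≤ 0<z (scaled n)
    where
    open ≤-Reasoning

    0≤u+x : 0# ≤ u + x
    0≤u+x = +-nonneg 0≤u 0≤x

    [1-u]y≈z : (1# - u) * y ≈ z
    [1-u]y≈z = trans (solve 2 (λ u y → (:1 :- u) :* y := y :- u :* y) refl u y)
      (trans (+-congˡ (-‿cong uy≈y-z)) (solve 2 (λ y z → y :- (y :- z) := z) refl y z))

    0≤1-u : 0# ≤ 1# - u
    0≤1-u = *-cancelʳ-≤ 0<y (≤-trans ℝ (≤-reflexive (zeroˡ y))
      (≤-trans ℝ (<⇒≤ 0<z) (≤-reflexive (sym [1-u]y≈z))))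

    scaled : ∀ n → a * euler (u + x) n * z ≤ y * z
    -- The factor 1 - u = z/y is at most vᴺ. Merging the powers gives (A v)ᴺ, and A v ≤ 1 + x r,
    -- which removes u from the exponent.
    scaled n = begin
      a * A ^ N * z               ≈⟨ *-congˡ [1-u]y≈z ⟨
      a * A ^ N * ((1# - u) * y)
        ≈⟨ solve 4 (λ a p q y → a :* p :* (q :* y) := y :* a :* p :* q) refl a (A ^ N) (1# - u) y ⟩
      y * a * A ^ N * (1# - u)
        ≤⟨ *-monoʳ-≤ (*-nonneg (*-nonneg (<⇒≤ 0<y) 0≤a) (^-nonneg N 0≤A)) 1-u≤vᴺ ⟩
      y * a * A ^ N * v ^ N       ≈⟨ *-assoc _ _ _ ⟩
      y * a * (A ^ N * v ^ N)     ≈⟨ *-congˡ (^-distrib-* A v N) ⟨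
      y * a * (A * v) ^ N
        ≤⟨ *-monoʳ-≤ (*-nonneg (<⇒≤ 0<y) 0≤a) (^-mono-≤ N (*-nonneg 0≤A 0≤v) Av≤B) ⟩
      y * a * euler x n           ≈⟨ *-assoc _ _ _ ⟩
      y * (a * euler x n)         ≤⟨ *-monoʳ-≤ (<⇒≤ 0<y) (bound n) ⟩
      y * z                       ∎
      where
      N = ℕ.suc n
      r = 1/[1+ n ]
      A = 1# + (u + x) * r
      v = 1# - u * r

      0≤A : 0# ≤ A
      0≤A = +-nonneg 0≤1 (*-nonneg 0≤u+x (0≤1/[1+n] n))

      0≤v : 0# ≤ v
      0≤v = begin
        0#                       ≤⟨ *-nonneg (0≤1/[1+n] n) (+-nonneg (0≤fromℕ n) 0≤1-u) ⟩
        r * (fromℕ n + (1# - u))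
          ≈⟨ solve 3 (λ r n u → r :* (n :+ (:1 :- u)) := (:1 :+ n) :* r :- u :* r)
               refl r (fromℕ n) u ⟩
        fromℕ N * r - u * r      ≈⟨ +-congʳ ([1+n]*1/[1+n]≈1 n) ⟩
        v                        ∎

      1-u≤vᴺ : 1# - u ≤ v ^ N
      1-u≤vᴺ = begin
        1# - u                    ≈⟨ solve 1 (λ u → :1 :- u := :1 :- u :* :1) refl u ⟩
        1# - u * 1#               ≈⟨ +-congˡ (-‿cong (*-congˡ ([1+n]*1/[1+n]≈1 n))) ⟨
        1# - u * (fromℕ N * r)
          ≈⟨ solve 3 (λ u k r → :1 :- u :* (k :* r) := :1 :+ k :* (:1 :- u :* r :- :1))
               refl u (fromℕ N) r ⟩
        1# + fromℕ N * (v - 1#)   ≤⟨ bernoulli N 0≤v ⟩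
        v ^ N                     ∎

      Av≤B : A * v ≤ 1# + x * r
      Av≤B = ≤-by (u * r * ((u + x) * r))
        (*-nonneg (*-nonneg 0≤u (0≤1/[1+n] n)) (*-nonneg 0≤u+x (0≤1/[1+n] n)))
        (solve 3 (λ u x r → :1 :+ x :* r :- (:1 :+ (u :+ x) :* r) :* (:1 :- u :* r)
                            := u :* r :* ((u :+ x) :* r)) refl u x r)

  limit-≤ : ∀ {s l K B} → ConvergesTo s l → 0# < K →
            ∀ N → (∀ n → N ℕ.≤ n → s n * K ≤ B) → l * K ≤ B
  limit-≤ {s} {l} {K} {B} s→l 0<K N sK≤B B<lK =
    sK≤B n (ℕₚ.m≤m⊔n N N′) (0<y-x⇒x<y (<-respʳ-≈
      (trans (solve 4 (λ δ l s K → (δ :- (l :- s)) :* K := δ :* K :- l :* K :+ s :* K)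
           refl δ l (s n) K)
        (trans (+-congʳ (+-congʳ δK≈lK-B))
          (solve 4 (λ l K B s → l :* K :- B :- l :* K :+ s :* K := s :* K :- B) refl l K B (s n))))
      (*-pos (x<y⇒0<y-x ℝ l-sₙ<δ) 0<K)))
    where
    -- For this δ, the inequality l - s n < δ multiplied by K is exactly B < s n * K.
    δ = (l * K - B) * recip ℝ K 0<K
    0<δ : 0# < δ
    0<δ = *-pos (x<y⇒0<y-x ℝ B<lK) (0<recip K 0<K)
    N′ = proj₁ (s→l δ 0<δ)
    n = N ℕ.⊔ N′
    l-sₙ<δ : l - s n < δ
    l-sₙ<δ = proj₂ (proj₂ (s→l δ 0<δ) n (ℕₚ.m≤n⊔m N N′))
    δK≈lK-B : δ * K ≈ l * K - B
    δK≈lK-B = trans (solve 3 (λ d r K → d :* r :* K := d :* (K :* r))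
         refl (l * K - B) (recip ℝ K 0<K) K)
      (trans (*-congˡ (recip-inverseʳ K 0<K)) (*-identityʳ _))

  -- Strict monotonicity of exp, made quantitative. If ℓ < x, the tangent inequality at 1 + ℓ/N and
  -- 1 + x/N gives, for large N, (1 + ℓ/N)ᴺ (1 + x + (x - ℓ)) ≤ (1 + x) (1 + x/N)ᴺ. Multiplied by ε,
  -- the right side is at most 1 + x. Since ε z = 1, the left side tends to 1 + x + (x - ℓ), which
  -- is larger.
  ExpBound⇒≤ln : ∀ {ε z ln-z x} → 0# < ε → ε * z ≈ 1# → IsLn ℝ z ln-z →
                 ExpBound x ε 1# → x ≤ ln-z
  ExpBound⇒≤ln {ε} {z} {ℓ} {x} 0<ε εz≈1 isLn (0≤x , bound) ℓ<x =
    limit-≤ isLn (*-pos 0<ε 0<D) N₀ aᴺεD≤1+x (<-respʳ-≈ D≈zεD 1+x<D)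
    where
    open ≤-Reasoning
    D = 1# + x + (x - ℓ)
    0<x-ℓ : 0# < x - ℓ
    0<x-ℓ = x<y⇒0<y-x ℝ ℓ<x
    1+x<D : 1# + x < D
    1+x<D = 0<y-x⇒x<y (<-respʳ-≈ (solve 2 (λ x ℓ → x :- ℓ := :1 :+ x :+ (x :- ℓ) :- (:1 :+ x))
         refl x ℓ) 0<x-ℓ)
    0<D : 0# < D
    0<D = ≤-<-trans (+-nonneg 0≤1 0≤x) 1+x<D
    D≈zεD : D ≈ z * (ε * D)
    D≈zεD = trans (sym (*-identityˡ D)) (trans (*-congʳ (sym εz≈1))
      (solve 3 (λ z ε D → ε :* z :* D := z :* (ε :* D)) refl z ε D))
    -- The sign of ℓ is not known here; from N₀ > -ℓ on, the base 1 + ℓ/N is nonnegative.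
    N₀ = proj₁ (archimedean (- ℓ))
    aᴺεD≤1+x : ∀ n → N₀ ℕ.≤ n → euler ℓ n * (ε * D) ≤ 1# + x
    aᴺεD≤1+x n N₀≤n = begin
      a ^ N * (ε * D)
        -- The tangent inequality carries the factor a, which depends on n. Adding the part with 1 +
        -- x - a, nonnegative because a ≤ b ≤ 1 + x, replaces it by the constant 1 + x.
        ≈⟨ solve 5 (λ p ε x ℓ a → p :* (ε :* (:1 :+ x :+ (x :- ℓ)))
                                               := ε :* (p :* (a :+ (x :- ℓ)) :+ (:1 :+ x :- a) :* p)) refl (a ^ N) ε x ℓ a ⟩
      ε * (a ^ N * (a + (x - ℓ)) + (1# + x - a) * a ^ N)
                                          ≈⟨ *-congˡ (+-congʳ (*-congˡ (+-congˡ N[b-a]≈x-ℓ))) ⟨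
      ε * (a ^ N * (a + fromℕ N * (b - a)) + (1# + x - a) * a ^ N)
        ≤⟨ *-monoʳ-≤ (<⇒≤ 0<ε) (+-mono-≤ (power-tangent N 0≤a (≤-trans ℝ 0≤a a≤b))
             (*-monoʳ-≤ (x≤y⇒0≤y-x (≤-trans ℝ a≤b b≤1+x)) (^-mono-≤ N 0≤a a≤b))) ⟩
      ε * (a * b ^ N + (1# + x - a) * b ^ N)
        ≈⟨ solve 4 (λ ε a q x → ε :* (a :* q :+ (:1 :+ x :- a) :* q) := (:1 :+ x) :* (ε :* q))
             refl ε a (b ^ N) x ⟩
      (1# + x) * (ε * b ^ N)              ≤⟨ *-monoʳ-≤ (+-nonneg 0≤1 0≤x) (bound n) ⟩
      (1# + x) * 1#                       ≈⟨ *-identityʳ _ ⟩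
      1# + x                              ∎
      where
      N = ℕ.suc n
      r = 1/[1+ n ]
      a = 1# + ℓ * r
      b = 1# + x * r

      0≤N+ℓ : 0# ≤ fromℕ N + ℓ
      0≤N+ℓ = begin
        0#            ≈⟨ -‿inverseˡ ℓ ⟨
        - ℓ + ℓ       ≤⟨ +-monoˡ-≤ ℓ (<⇒≤ (proj₂ (archimedean (- ℓ)))) ⟩
        fromℕ N₀ + ℓ  ≤⟨ +-monoˡ-≤ ℓ (fromℕ-mono-≤ (ℕₚ.m≤n⇒m≤1+n N₀≤n)) ⟩
        fromℕ N + ℓ   ∎

      0≤a : 0# ≤ a
      0≤a = begin
        0#                 ≤⟨ *-nonneg 0≤N+ℓ (0≤1/[1+n] n) ⟩
        (fromℕ N + ℓ) * r  ≈⟨ distribʳ r (fromℕ N) ℓ ⟩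
        fromℕ N * r + ℓ * r ≈⟨ +-congʳ ([1+n]*1/[1+n]≈1 n) ⟩
        a                  ∎

      a≤b : a ≤ b
      a≤b = +-monoʳ-≤ 1# (*-monoˡ-≤ (0≤1/[1+n] n) (<⇒≤ ℓ<x))

      b≤1+x : b ≤ 1# + x
      b≤1+x = +-monoʳ-≤ 1# (≤-trans ℝ (*-monoʳ-≤ 0≤x (1/[1+n]≤1 n)) (≤-reflexive (*-identityʳ x)))

      N[b-a]≈x-ℓ : fromℕ N * (b - a) ≈ x - ℓ
      N[b-a]≈x-ℓ = trans (solve 4 (λ k x ℓ r → k :* (:1 :+ x :* r :- (:1 :+ ℓ :* r)) := (x :- ℓ) :* (k :* r))
           refl (fromℕ N) x ℓ r)
        (trans (*-congˡ ([1+n]*1/[1+n]≈1 n)) (*-identityʳ _))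

-- Sums over intervals of indices and the histogram argument.

module Summation {c ℓ₁ ℓ₂ : Level} (ℝ : RealNumbers c ℓ₁ ℓ₂) where
  open RealNumbers ℝ hiding (zero)
  open RealProperties ℝ
  open ≤-Reasoning

  -- Given by length and start, so that dropping the first term is the recursive call and every tail
  -- is again of this form.
  sumFrom : (ℕ → Carrier) → ℕ → ℕ → Carrier
  sumFrom u ℕ.zero    t = 0#
  sumFrom u (ℕ.suc d) t = u t + sumFrom u d (ℕ.suc t)

  sumFrom-nonneg : ∀ {u} → (∀ t → 0# ≤ u t) → ∀ d t → 0# ≤ sumFrom u d t
  sumFrom-nonneg 0≤u ℕ.zero    t = ≤-refl
  sumFrom-nonneg 0≤u (ℕ.suc d) t = +-nonneg (0≤u t) (sumFrom-nonneg 0≤u d (ℕ.suc t))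

  *-distribˡ-sumFrom : ∀ a u d t → a * sumFrom u d t ≈ sumFrom (λ t → a * u t) d t
  *-distribˡ-sumFrom a u ℕ.zero    t = zeroʳ a
  *-distribˡ-sumFrom a u (ℕ.suc d) t =
    trans (distribˡ a _ _) (+-congˡ (*-distribˡ-sumFrom a u d (ℕ.suc t)))

  sumFrom-sum-comm : ∀ {n} (g : Fin n → ℕ → Carrier) d t →
                     sumFrom (λ t → sum λ i → g i t) d t ≈ sum λ i → sumFrom (g i) d t
  sumFrom-sum-comm {n} g ℕ.zero    t = sym (sum-replicate-zero n)
  sumFrom-sum-comm     g (ℕ.suc d) t = trans (+-congˡ (sumFrom-sum-comm g d (ℕ.suc t)))
    (sym (∑-distrib-+ (λ i → g i t) (λ i → sumFrom (g i) d (ℕ.suc t))))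

  fromℕ≤sumFrom : ∀ {u} → (∀ q → 0# ≤ u q) → ∀ {c d} t → c ℕ.≤ d →
                  (∀ q → q ℕ.< t ℕ.+ c → 1# ≤ u q) → fromℕ c ≤ sumFrom u d t
  fromℕ≤sumFrom 0≤u t (ℕ.z≤n {d})             1≤u = sumFrom-nonneg 0≤u d t
  fromℕ≤sumFrom 0≤u t (ℕ.s≤s {c} {d} c≤d) 1≤u = +-mono-≤
    (1≤u t (ℕₚ.m<m+n t ℕ.z<s))
    (fromℕ≤sumFrom 0≤u (ℕ.suc t) c≤d λ q q<1+t+c →
      1≤u q (ℕₚ.≤-trans q<1+t+c (ℕₚ.≤-reflexive (≡.sym (ℕₚ.+-suc t c)))))

  -- Only indices from t up to c - 1 can contribute; the truncated difference makes the bound 0 once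
  -- t has passed c.
  sumFrom≤fromℕ : ∀ {u c} → (∀ q → u q ≤ 1#) → (∀ q → c ℕ.≤ q → u q ≤ 0#) →
                  ∀ d t → sumFrom u d t ≤ fromℕ (c ℕ.∸ t)
  sumFrom≤fromℕ {u} {c} u≤1 u≤0 ℕ.zero    t = 0≤fromℕ (c ℕ.∸ t)
  sumFrom≤fromℕ {u} {c} u≤1 u≤0 (ℕ.suc d) t with ℕₚ.<-≤-connex t c
  ... | inj₁ t<c = begin
    u t + sumFrom u d (ℕ.suc t)       ≤⟨ +-mono-≤ (u≤1 t) (sumFrom≤fromℕ u≤1 u≤0 d (ℕ.suc t)) ⟩
    fromℕ (ℕ.suc (c ℕ.∸ ℕ.suc t))     ≡⟨ ≡.cong fromℕ (ℕₚ.+-∸-assoc 1 t<c) ⟨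
    fromℕ (c ℕ.∸ t)                   ∎
  ... | inj₂ c≤t = begin
    u t + sumFrom u d (ℕ.suc t)       ≤⟨ +-mono-≤ (u≤0 t c≤t) (sumFrom≤fromℕ u≤1 u≤0 d (ℕ.suc t)) ⟩
    0# + fromℕ (c ℕ.∸ ℕ.suc t)        ≈⟨ +-identityˡ _ ⟩
    fromℕ (c ℕ.∸ ℕ.suc t)             ≤⟨ fromℕ-mono-≤ (ℕₚ.∸-monoʳ-≤ c (ℕₚ.n≤1+n t)) ⟩
    fromℕ (c ℕ.∸ t)                   ∎

  -- Feige, Lovász and Tetali's histogram argument as an induction on the pair
  -- (t , s): if R t is at least 2 Q s, advance t, charging R t to 2 s P t;
  -- otherwise advance s, paying for the factor s + 1 with Q s, since the
  -- remaining P sum to at most L (R t) ≤ 2 L (Q s).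
  histogram : ∀ {n L} {R P Q : ℕ → Carrier} → 0# ≤ L →
              (∀ t → 0# ≤ R t) → (∀ t → 0# ≤ P t) → (∀ s → 0# ≤ Q s) → Q n ≤ 0# →
              (∀ d t → t ℕ.+ d ≡ n → sumFrom P d t ≤ L * R t) →
              (∀ {s t} → t ℕ.< n → s ℕ.≤ n → R t ≤ fromℕ s * P t + Q s) →
              ∀ d t → t ℕ.+ d ≡ n → ∀ e s → s ℕ.+ e ≡ n →
              sumFrom R d t ≤ fromℕ 2 * fromℕ s * sumFrom P d t + fromℕ 4 * L * sumFrom Q e s
  histogram {n} {L} {R} {P} {Q} 0≤L 0≤R 0≤P 0≤Q Qn≤0 tail cover = go
    where
    0≤4L : 0# ≤ fromℕ 4 * L
    0≤4L = *-nonneg (0≤fromℕ 4) 0≤L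

    t<n : ∀ d {t} → t ℕ.+ ℕ.suc d ≡ n → t ℕ.< n
    t<n d {t} eq = ≡.subst (t ℕ.<_) eq (ℕₚ.m<m+n t ℕ.z<s)

    s≤n : ∀ e {s} → s ℕ.+ e ≡ n → s ℕ.≤ n
    s≤n e {s} eq = ≡.subst (s ℕ.≤_) eq (ℕₚ.m≤m+n s e)

    shift : ∀ d {t} → t ℕ.+ ℕ.suc d ≡ n → ℕ.suc t ℕ.+ d ≡ n
    shift d {t} eq = ≡.trans (≡.sym (ℕₚ.+-suc t d)) eq

    light : ∀ d e {s t} → t ℕ.+ ℕ.suc d ≡ n → s ℕ.+ e ≡ n → fromℕ 2 * Q s ≤ R t →
            R t ≤ fromℕ 2 * fromℕ s * P t
    light d e {s} {t} t+d≡n s+e≡n 2Q≤R = ≤-by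
      -- Twice `cover` reads 2 R t ≤ 2 s P t + 2 Q s, and one of the two R t pays for 2 Q s.
      (fromℕ 2 * (fromℕ s * P t + Q s - R t) + (R t - fromℕ 2 * Q s))
      (+-nonneg (*-nonneg (0≤fromℕ 2) (x≤y⇒0≤y-x (cover (t<n d t+d≡n) (s≤n e s+e≡n)))) (x≤y⇒0≤y-x 2Q≤R))
      (solve 4 (λ s p q r →
         let two = :1 :+ (:1 :+ :0) in
         two :* s :* p :- r := two :* (s :* p :+ q :- r) :+ (r :- two :* q))
        refl (fromℕ s) (P t) (Q s) (R t))

    advance : ∀ d {t} s X → R t ≤ fromℕ 2 * fromℕ s * P t →
              sumFrom R d (ℕ.suc t) ≤ fromℕ 2 * fromℕ s * sumFrom P d (ℕ.suc t) + X →
              sumFrom R (ℕ.suc d) t ≤ fromℕ 2 * fromℕ s * sumFrom P (ℕ.suc d) t + X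
    advance d {t} s X R≤ ih = begin
      R t + sumFrom R d (ℕ.suc t)              ≤⟨ +-mono-≤ R≤ ih ⟩
      fromℕ 2 * fromℕ s * P t + (fromℕ 2 * fromℕ s * sumFrom P d (ℕ.suc t) + X)
        ≈⟨ solve 4 (λ a p q x → a :* p :+ (a :* q :+ x) := a :* (p :+ q) :+ x) refl
             (fromℕ 2 * fromℕ s) (P t) (sumFrom P d (ℕ.suc t)) X ⟩
      fromℕ 2 * fromℕ s * (P t + sumFrom P d (ℕ.suc t)) + X ∎

    go : ∀ d t → t ℕ.+ d ≡ n → ∀ e s → s ℕ.+ e ≡ n →
         sumFrom R d t ≤ fromℕ 2 * fromℕ s * sumFrom P d t + fromℕ 4 * L * sumFrom Q e s
    go ℕ.zero t t+d≡n e s s+e≡n = begin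
      0#
        ≤⟨ *-nonneg 0≤4L (sumFrom-nonneg 0≤Q e s) ⟩
      fromℕ 4 * L * sumFrom Q e s                             ≈⟨ +-identityˡ _ ⟨
      0# + fromℕ 4 * L * sumFrom Q e s                        ≈⟨ +-congʳ (zeroʳ _) ⟨
      fromℕ 2 * fromℕ s * 0# + fromℕ 4 * L * sumFrom Q e s    ∎
    -- At s = n no step of s is left, and Q n ≤ 0 makes the light case apply outright.
    go (ℕ.suc d) t t+d≡n ℕ.zero s s+0≡n =
      advance d s _ (light d 0 t+d≡n s+0≡n 2Q≤R) (go d (ℕ.suc t) (shift d t+d≡n) 0 s s+0≡n)
      where
      2Q≤R : fromℕ 2 * Q s ≤ R t
      2Q≤R = begin
        fromℕ 2 * Q s ≡⟨ ≡.cong (λ s → fromℕ 2 * Q s) (≡.trans (≡.sym (ℕₚ.+-identityʳ s)) s+0≡n) ⟩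
        fromℕ 2 * Q n ≤⟨ *-monoʳ-≤ (0≤fromℕ 2) Qn≤0 ⟩
        fromℕ 2 * 0#  ≈⟨ zeroʳ _ ⟩
        0#            ≤⟨ 0≤R t ⟩
        R t           ∎
    go (ℕ.suc d) t t+d≡n (ℕ.suc e) s s+e≡n = by-cases (fromℕ 2 * Q s) (R t)
      (λ 2Q≤R → advance d s _ (light d (ℕ.suc e) t+d≡n s+e≡n 2Q≤R)
        (go d (ℕ.suc t) (shift d t+d≡n) (ℕ.suc e) s s+e≡n))
      λ R≤2Q → begin
        sumFrom R (ℕ.suc d) t ≤⟨ go (ℕ.suc d) t t+d≡n e (ℕ.suc s) (shift e s+e≡n) ⟩
        fromℕ 2 * fromℕ (ℕ.suc s) * ΣP + fromℕ 4 * L * ΣQ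
          ≤⟨ ≤-by (fromℕ 2 * (L * R t - ΣP) + fromℕ 2 * (L * (fromℕ 2 * Q s - R t)))
               (+-nonneg (*-nonneg (0≤fromℕ 2) (x≤y⇒0≤y-x (tail (ℕ.suc d) t t+d≡n)))
                 (*-nonneg (0≤fromℕ 2) (*-nonneg 0≤L (x≤y⇒0≤y-x R≤2Q))))
               (solve 6 (λ s p l q q′ r →
                  let two = :1 :+ (:1 :+ :0)
                      four = :1 :+ (:1 :+ two) in
                  two :* s :* p :+ four :* l :* (q :+ q′)
                    :- (two :* (:1 :+ s) :* p :+ four :* l :* q′)
                  := two :* (l :* r :- p) :+ two :* (l :* (two :* q :- r)))
                 refl (fromℕ s) ΣP L (Q s) ΣQ (R t)) ⟩
        fromℕ 2 * fromℕ s * ΣP + fromℕ 4 * L * (Q s + ΣQ) ∎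
      where
      ΣP = sumFrom P (ℕ.suc d) t
      ΣQ = sumFrom Q e (ℕ.suc s)

-- Prefixes of a permutation as sets.

module Prefix {n} (π : Permutation′ n) where

  ∈-prefix⁺ : ∀ {t e} → toℕ (π ⟨$⟩ˡ e) ℕ.< t → e ∈ prefix π t
  ∈-prefix⁺ {t} {e} p<t = lookup⇒[]= e (prefix π t)
    (≡.trans (lookup∘tabulate _ e) (dec-true (toℕ (π ⟨$⟩ˡ e) ℕₚ.<? t) p<t))

  ∈-prefix⁻ : ∀ {t e} → e ∈ prefix π t → toℕ (π ⟨$⟩ˡ e) ℕ.< t
  ∈-prefix⁻ {t} {e} e∈ = does⇒ (toℕ (π ⟨$⟩ˡ e) ℕₚ.<? t)
    (≡.trans (≡.sym (lookup∘tabulate _ e)) ([]=⇒lookup e∈))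
    where
    does⇒ : ∀ {p} {P : Set p} (P? : Dec P) → does P? ≡ true → P
    does⇒ (yes p) _ = p

  prefix-mono-⊆ : ∀ {s t} → s ℕ.≤ t → prefix π s ⊆ prefix π t
  prefix-mono-⊆ s≤t e∈ = ∈-prefix⁺ (ℕₚ.<-≤-trans (∈-prefix⁻ e∈) s≤t)

  prefix-zero-⊆ : ∀ {S} → prefix π 0 ⊆ S
  prefix-zero-⊆ e∈ with () ← ∈-prefix⁻ {0} e∈

  prefix-suc-⊆ : ∀ p → prefix π (ℕ.suc (toℕ p)) ⊆ prefix π (toℕ p) ∪ ⁅ π ⟨$⟩ʳ p ⁆
  prefix-suc-⊆ p {e} e∈ with ℕₚ.m≤n⇒m<n∨m≡n (ℕ.s≤s⁻¹ (∈-prefix⁻ e∈))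
  ... | inj₁ q<p = x∈p∪q⁺ (inj₁ (∈-prefix⁺ q<p))
  ... | inj₂ q≡p = x∈p∪q⁺ (inj₂ (≡.subst (_∈ ⁅ π ⟨$⟩ʳ p ⁆)
    (≡.trans (≡.cong (π ⟨$⟩ʳ_) (≡.sym (toℕ-injective q≡p))) (inverseʳ π)) (x∈⁅x⁆ _)))

  ⁅⁆-⊆-prefix : ∀ p → ⁅ π ⟨$⟩ʳ p ⁆ ⊆ prefix π (ℕ.suc (toℕ p))
  ⁅⁆-⊆-prefix p e∈ with ≡.refl ← x∈⁅y⁆⇒x≡y _ e∈ =
    ∈-prefix⁺ (ℕ.s≤s (ℕₚ.≤-reflexive (≡.cong toℕ (inverseˡ π))))

-- Normalized marginal gains and the weight of uncovered functions.

module Marginals {c ℓ₁ ℓ₂ : Level} (ℝ : RealNumbers c ℓ₁ ℓ₂) {n k m : ℕ} (I : SRMA ℝ n k m) where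
  open RealNumbers ℝ hiding (zero)
  open RealProperties ℝ
  open Logarithm ℝ
  open Summation ℝ
  open SRMA I
  open ≤-Reasoning

  ∑∑ : (Fin k → Fin m → Carrier) → Carrier
  ∑∑ g = sum λ i → sum λ j → g i j

  ∑∑-mono-≤ : ∀ {g h} → (∀ i j → g i j ≤ h i j) → ∑∑ g ≤ ∑∑ h
  ∑∑-mono-≤ g≤h = sum-mono-≤ λ i → sum-mono-≤ (g≤h i)

  ∑∑-nonneg : ∀ {g} → (∀ i j → 0# ≤ g i j) → 0# ≤ ∑∑ g
  ∑∑-nonneg 0≤g = sum-nonneg λ i → sum-nonneg (0≤g i)

  ∑∑-distrib-+ : ∀ g h → ∑∑ (λ i j → g i j + h i j) ≈ ∑∑ g + ∑∑ h
  ∑∑-distrib-+ g h = trans (sum-cong-≋ λ i → ∑-distrib-+ (g i) (h i))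
    (∑-distrib-+ (λ i → sum (g i)) (λ i → sum (h i)))

  *-distribˡ-∑∑ : ∀ a g → a * ∑∑ g ≈ ∑∑ (λ i j → a * g i j)
  *-distribˡ-∑∑ a g = trans (*-distribˡ-sum a (λ i → sum (g i))) (sum-cong-≋ λ i → *-distribˡ-sum a (g i))

  sumFrom-∑∑-comm : ∀ (g : Fin k → Fin m → ℕ → Carrier) d t →
                    sumFrom (λ t → ∑∑ λ i j → g i j t) d t ≈ ∑∑ λ i j → sumFrom (g i j) d t
  sumFrom-∑∑-comm g d t =
    trans (sumFrom-sum-comm (λ i t → sum λ j → g i j t) d t) (sum-cong-≋ λ i → sumFrom-sum-comm (g i) d t)

  -- The result type of `covered`. Lemmas about a single function take an arbitrary inhabitant, so
  -- that they can split on it directly instead of abstracting over the call.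
  Covered⊎ : Fin k → Fin m → Subset n → Set (ℓ₁ ⊔ ℓ₂)
  Covered⊎ i j S = f i j S ≈ 1# ⊎ f i j S < 1#

  covered-⊆ : ∀ i j {S T} → S ⊆ T → f i j S ≈ 1# → f i j T ≈ 1#
  covered-⊆ i j {S} {T} S⊆T fS≈1 = ≤-antisym ℝ (f-≤1 i j T) (≤-trans ℝ (≤-reflexive (sym fS≈1)) (monotone i j S⊆T))

  -- The term of function (i , j) in the score, for a set A in place of ⁅ e ⁆.
  marginal : ∀ i j S → Subset n → Covered⊎ i j S → Carrier
  marginal i j S A = [ (λ _ → 0#)
    , (λ f<1 → w i j * ((f i j (S ∪ A) - f i j S) * recip ℝ (1# - f i j S) (x<y⇒0<y-x ℝ f<1))) ]′

  -- At a singleton this unfolds to `score S e`, so the greedy hypothesis applies to it without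
  -- conversion. Allowing arbitrary sets makes subadditivity expressible.
  gain : Subset n → Subset n → Carrier
  gain S A = ∑∑ λ i j → marginal i j S A (covered i j S)

  0≤w : ∀ i j → 0# ≤ w i j
  0≤w i j = <⇒≤ (w-pos i j)

  0≤recip : ∀ i j {S} (f<1 : f i j S < 1#) → 0# ≤ recip ℝ (1# - f i j S) (x<y⇒0<y-x ℝ f<1)
  0≤recip i j f<1 = <⇒≤ (0<recip _ (x<y⇒0<y-x ℝ f<1))

  weigh-mono : ∀ i j {S x y} (f<1 : f i j S < 1#) → x ≤ y →
               w i j * (x * recip ℝ (1# - f i j S) (x<y⇒0<y-x ℝ f<1)) ≤
               w i j * (y * recip ℝ (1# - f i j S) (x<y⇒0<y-x ℝ f<1))
  weigh-mono i j f<1 x≤y = *-monoʳ-≤ (0≤w i j) (*-monoˡ-≤ (0≤recip i j f<1) x≤y)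

  ∪-monoʳ-⊆ : ∀ (S : Subset n) {A B} → A ⊆ B → S ∪ A ⊆ S ∪ B
  ∪-monoʳ-⊆ S {A} A⊆B x∈ = x∈p∪q⁺ (map₂ A⊆B (x∈p∪q⁻ S A x∈))

  marginal-mono : ∀ i j S {A B} → A ⊆ B → (c : Covered⊎ i j S) → marginal i j S A c ≤ marginal i j S B c
  marginal-mono i j S A⊆B (inj₁ _)   = ≤-refl
  marginal-mono i j S A⊆B (inj₂ f<1) =
    weigh-mono i j f<1 (+-monoˡ-≤ _ (monotone i j (∪-monoʳ-⊆ S A⊆B)))

  marginal-nonneg : ∀ i j S A (c : Covered⊎ i j S) → 0# ≤ marginal i j S A c
  marginal-nonneg i j S A (inj₁ _)   = ≤-refl
  marginal-nonneg i j S A (inj₂ f<1) =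
    *-nonneg (0≤w i j) (*-nonneg (x≤y⇒0≤y-x (monotone i j (p⊆p∪q A))) (0≤recip i j f<1))

  marginal-⊆ : ∀ i j S {A} → A ⊆ S → (c : Covered⊎ i j S) → marginal i j S A c ≤ 0#
  marginal-⊆ i j S A⊆S (inj₁ _)   = ≤-refl
  marginal-⊆ i j S {A} A⊆S (inj₂ f<1) = begin
    w i j * ((f i j (S ∪ A) - f i j S) * _)
      ≤⟨ weigh-mono i j f<1 (+-monoˡ-≤ _ (monotone i j S∪A⊆S)) ⟩
    w i j * ((f i j S - f i j S) * _)
      ≈⟨ solve 3 (λ w x r → w :* ((x :- x) :* r) := :0) refl _ _ _ ⟩
    0#                                      ∎
    where
    S∪A⊆S : S ∪ A ⊆ S
    S∪A⊆S x∈ = [ (λ x∈S → x∈S) , A⊆S ]′ (x∈p∪q⁻ S A x∈)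

  -- Submodularity applied to S ∪ A and S ∪ B, whose intersection contains S.
  marginal-subadditive : ∀ i j S {A B C} → C ⊆ A ∪ B → (c : Covered⊎ i j S) →
                         marginal i j S C c ≤ marginal i j S A c + marginal i j S B c
  marginal-subadditive i j S C⊆A∪B (inj₁ _)   = ≤-reflexive (sym (+-identityˡ 0#))
  marginal-subadditive i j S {A} {B} {C} C⊆A∪B (inj₂ f<1) = begin
    w i j * ((f i j (S ∪ C) - f i j S) * r)
      ≤⟨ weigh-mono i j f<1 (≤-by
           (f i j (S ∪ A) + f i j (S ∪ B) - (f i j X + f i j Y)
             + (f i j X - f i j (S ∪ C)) + (f i j Y - f i j S))
           (+-nonneg
             (+-nonneg (x≤y⇒0≤y-x (submodular i j (S ∪ A) (S ∪ B)))
                       (x≤y⇒0≤y-x (monotone i j S∪C⊆X)))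
             (x≤y⇒0≤y-x (monotone i j S⊆Y)))
           (solve 6 (λ s a b c x y → a :- s :+ (b :- s) :- (c :- s) := a :+ b :- (x :+ y) :+ (x :- c) :+ (y :- s))
             refl (f i j S) (f i j (S ∪ A)) (f i j (S ∪ B)) (f i j (S ∪ C)) (f i j X) (f i j Y))) ⟩
    w i j * ((f i j (S ∪ A) - f i j S + (f i j (S ∪ B) - f i j S)) * r)
      ≈⟨ solve 4 (λ w a b r → w :* ((a :+ b) :* r) := w :* (a :* r) :+ w :* (b :* r)) refl _ _ _ r ⟩
    w i j * ((f i j (S ∪ A) - f i j S) * r) + w i j * ((f i j (S ∪ B) - f i j S) * r) ∎
    where
    r = recip ℝ (1# - f i j S) (x<y⇒0<y-x ℝ f<1)
    X = (S ∪ A) ∪ (S ∪ B)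
    Y = (S ∪ A) ∩ (S ∪ B)
    S⊆Y : S ⊆ Y
    S⊆Y x∈S = x∈p∩q⁺ (p⊆p∪q A x∈S , p⊆p∪q B x∈S)
    S∪C⊆X : S ∪ C ⊆ X
    S∪C⊆X x∈ with x∈p∪q⁻ S C x∈
    ... | inj₁ x∈S = x∈p∪q⁺ (inj₁ (p⊆p∪q A x∈S))
    ... | inj₂ x∈C with x∈p∪q⁻ A B (C⊆A∪B x∈C)
    ...   | inj₁ x∈A = x∈p∪q⁺ (inj₁ (q⊆p∪q S A x∈A))
    ...   | inj₂ x∈B = x∈p∪q⁺ (inj₂ (q⊆p∪q S B x∈B))

  uncovered : ∀ {i j S} → Covered⊎ i j S → Carrier
  uncovered = [ (λ _ → 0#) , (λ _ → 1#) ]′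

  uncovered-nonneg : ∀ {i j S} (c : Covered⊎ i j S) → 0# ≤ uncovered c
  uncovered-nonneg (inj₁ _) = ≤-refl
  uncovered-nonneg (inj₂ _) = 0≤1

  uncovered-≤1 : ∀ {i j S} (c : Covered⊎ i j S) → uncovered c ≤ 1#
  uncovered-≤1 (inj₁ _) = 0≤1
  uncovered-≤1 (inj₂ _) = ≤-refl

  uncovered-≤0 : ∀ {i j S} → f i j S ≈ 1# → (c : Covered⊎ i j S) → uncovered c ≤ 0#
  uncovered-≤0 f≈1 (inj₁ _)   = ≤-refl
  uncovered-≤0 f≈1 (inj₂ f<1) = contradiction f<1 (<-irrefl f≈1)

  1≤uncovered : ∀ {i j S} → ¬ (f i j S ≈ 1#) → (c : Covered⊎ i j S) → 1# ≤ uncovered c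
  1≤uncovered f≉1 (inj₁ f≈1) = contradiction f≈1 f≉1
  1≤uncovered f≉1 (inj₂ _)   = ≤-refl

  -- Along the prefixes of π and of σ these are the quantities R and Q.
  uncoveredWeight : Subset n → Carrier
  uncoveredWeight S = ∑∑ λ i j → w i j * uncovered (covered i j S)

  -- A set A covering a function that S leaves uncovered has marginal w.
  uncovered-split : ∀ i j S A (c : Covered⊎ i j S) (c′ : Covered⊎ i j A) →
                    w i j * uncovered c ≤ marginal i j S A c + w i j * uncovered c′
  uncovered-split i j S A (inj₁ f≈1) c′ = begin
    w i j * 0#                    ≈⟨ zeroʳ _ ⟩
    0#                            ≤⟨ +-nonneg ≤-refl (*-nonneg (0≤w i j) (uncovered-nonneg c′)) ⟩
    0# + w i j * uncovered c′     ∎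
  uncovered-split i j S A c@(inj₂ _) (inj₂ _) = begin
    w i j * 1#                       ≈⟨ +-identityˡ _ ⟨
    0# + w i j * 1#                  ≤⟨ +-monoˡ-≤ _ (marginal-nonneg i j S A c) ⟩
    marginal i j S A c + w i j * 1#  ∎
  uncovered-split i j S A c@(inj₂ f<1) (inj₁ fA≈1) = begin
    w i j * 1#                          ≈⟨ *-congˡ (recip-inverseʳ _ (x<y⇒0<y-x ℝ f<1)) ⟨
    w i j * ((1# - f i j S) * _)
      ≈⟨ *-congˡ (*-congʳ (+-congʳ (covered-⊆ i j (q⊆p∪q S A) fA≈1))) ⟨
    marginal i j S A c                  ≈⟨ +-identityʳ _ ⟨
    marginal i j S A c + 0#             ≈⟨ +-congˡ (zeroʳ _) ⟨
    marginal i j S A c + w i j * 0#     ∎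

  uncoveredWeight-split : ∀ S A → uncoveredWeight S ≤ gain S A + uncoveredWeight A
  uncoveredWeight-split S A = ≤-trans ℝ
    (∑∑-mono-≤ λ i j → uncovered-split i j S A (covered i j S) (covered i j A))
    (≤-reflexive (∑∑-distrib-+ _ _))

  gain-nonneg : ∀ S A → 0# ≤ gain S A
  gain-nonneg S A = ∑∑-nonneg λ i j → marginal-nonneg i j S A (covered i j S)

  gain-mono : ∀ S {A B} → A ⊆ B → gain S A ≤ gain S B
  gain-mono S A⊆B = ∑∑-mono-≤ λ i j → marginal-mono i j S A⊆B (covered i j S)

  gain-⊆ : ∀ S {A} → A ⊆ S → gain S A ≤ 0#
  gain-⊆ S {A} A⊆S = begin
    gain S A                        ≤⟨ ∑∑-mono-≤ (λ i j → marginal-⊆ i j S A⊆S (covered i j S)) ⟩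
    ∑∑ (λ _ _ → 0#)
      ≈⟨ trans (sum-cong-≋ {k} λ _ → sum-replicate-zero m) (sum-replicate-zero k) ⟩
    0#                              ∎

  gain-subadditive : ∀ S {A B C} → C ⊆ A ∪ B → gain S C ≤ gain S A + gain S B
  gain-subadditive S C⊆A∪B = ≤-trans ℝ
    (∑∑-mono-≤ λ i j → marginal-subadditive i j S C⊆A∪B (covered i j S))
    (≤-reflexive (∑∑-distrib-+ _ _))

  -- The averaging argument without division: by subadditivity the prefix gains at most what its s
  -- elements gain separately.
  gain-prefix : ∀ (σ : Permutation′ n) S {B} → (∀ e → gain S ⁅ e ⁆ ≤ B) →
                ∀ s → s ℕ.≤ n → gain S (prefix σ s) ≤ fromℕ s * B
  gain-prefix σ S {B} gain≤B ℕ.zero    _   =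
    ≤-trans ℝ (gain-⊆ S (Prefix.prefix-zero-⊆ σ)) (≤-reflexive (sym (zeroˡ B)))
  gain-prefix σ S {B} gain≤B (ℕ.suc s) s<n = begin
    gain S (prefix σ (ℕ.suc s))                ≤⟨ gain-subadditive S prefix-suc ⟩
    gain S (prefix σ s) + gain S ⁅ σ ⟨$⟩ʳ p ⁆  ≤⟨ +-mono-≤ (gain-prefix σ S gain≤B s (ℕₚ.<⇒≤ s<n)) (gain≤B _) ⟩
    fromℕ s * B + B
      ≈⟨ solve 2 (λ s b → s :* b :+ b := (:1 :+ s) :* b) refl (fromℕ s) B ⟩
    fromℕ (ℕ.suc s) * B                        ∎
    where
    p = fromℕ< s<n
    prefix-suc : prefix σ (ℕ.suc s) ⊆ prefix σ s ∪ ⁅ σ ⟨$⟩ʳ p ⁆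
    prefix-suc = ≡.subst (λ q → prefix σ (ℕ.suc q) ⊆ prefix σ q ∪ ⁅ σ ⟨$⟩ʳ p ⁆)
      (toℕ-fromℕ< s<n) (Prefix.prefix-suc-⊆ σ p)

  -- The increase from f(S) to f(⊤) = 1 is itself a nonzero marginal value.
  ε≤1-f : ∀ i j {S} → f i j S < 1# → ε ≤ 1# - f i j S
  ε≤1-f i j f<1 = ≤-trans ℝ (ε-lower i j ⊆⊤ (<-respʳ-≈ (sym (f-⊤ i j)) f<1)) (≤-reflexive (+-congʳ (f-⊤ i j)))

  -- ε is attained as a difference of two values in [0, 1]. This makes ln (1/ε) nonnegative.
  ε≤1 : ε ≤ 1#
  ε≤1 with i , j , S , T , _ , _ , fT-fS≈ε ← ε-attained = begin
    ε                   ≈⟨ fT-fS≈ε ⟨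
    f i j T - f i j S
      ≤⟨ ≤-by (1# - f i j T + f i j S) (+-nonneg (x≤y⇒0≤y-x (f-≤1 i j T)) (f-nonneg i j S))
                             (solve 2 (λ s t → :1 :- (t :- s) := :1 :- t :+ s)
                                  refl (f i j S) (f i j T)) ⟩
    1#                  ∎

  -- A single function along an increasing chain of sets.

  module _ (S : ℕ → Subset n) (S-⊆ : ∀ t → S t ⊆ S (ℕ.suc t)) (i : Fin k) (j : Fin m) where
    y : ℕ → Carrier
    y t = 1# - f i j (S t)

    step : ∀ t → Covered⊎ i j (S t) → Carrier
    step t = marginal i j (S t) (S (ℕ.suc t))

    steps : ℕ → ℕ → Carrier
    steps = sumFrom λ t → step t (covered i j (S t))

    -- Here u = 1 - y (t + 1) / y t is the fraction of the residual removed by the step, in the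
    -- division-free form that `ExpBound-step` takes.
    step-ratio : ∀ t (c : Covered⊎ i j (S t)) → f i j (S t) < 1# →
                 ∃[ u ] (step t c ≈ w i j * u) × 0# ≤ u × u * y t ≈ y t - y (ℕ.suc t)
    step-ratio t (inj₁ f≈1) f<1 = contradiction f<1 (<-irrefl f≈1)
    step-ratio t (inj₂ f<1) _ = a * r , refl ,
      *-nonneg (x≤y⇒0≤y-x (monotone i j (p⊆p∪q (S (ℕ.suc t))))) (0≤recip i j f<1) ,
      (begin-equality
        a * r * y t     ≈⟨ solve 3 (λ a r y → a :* r :* y := a :* (y :* r)) refl a r (y t) ⟩
        a * (y t * r)   ≈⟨ *-congˡ (recip-inverseʳ _ (x<y⇒0<y-x ℝ f<1)) ⟩
        a * 1#          ≈⟨ *-identityʳ a ⟩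
        f i j (S t ∪ S (ℕ.suc t)) - f i j (S t) ≈⟨ +-congʳ f∪≈f ⟩
        f i j (S (ℕ.suc t)) - f i j (S t)
          ≈⟨ solve 2 (λ a b → b :- a := :1 :- a :- (:1 :- b))
               refl (f i j (S t)) (f i j (S (ℕ.suc t))) ⟩
        y t - y (ℕ.suc t)                       ∎)
      where
      a = f i j (S t ∪ S (ℕ.suc t)) - f i j (S t)
      r = recip ℝ (1# - f i j (S t)) (x<y⇒0<y-x ℝ f<1)
      f∪≈f : f i j (S t ∪ S (ℕ.suc t)) ≈ f i j (S (ℕ.suc t))
      f∪≈f = ≤-antisym ℝ
        (monotone i j λ x∈ → [ S-⊆ t , (λ x∈S → x∈S) ]′ (x∈p∪q⁻ (S t) (S (ℕ.suc t)) x∈))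
        (monotone i j (q⊆p∪q (S t) (S (ℕ.suc t))))

    steps-covered : ∀ d t → f i j (S t) ≈ 1# → steps d t ≤ 0#
    steps-covered ℕ.zero    t f≈1 = ≤-refl
    steps-covered (ℕ.suc d) t f≈1 = begin
      step t (covered i j (S t)) + steps d (ℕ.suc t)
        ≤⟨ +-mono-≤ (step≤0 (covered i j (S t))) (steps-covered d (ℕ.suc t) (covered-⊆ i j (S-⊆ t) f≈1)) ⟩
      0# + 0#                                        ≈⟨ +-identityˡ 0# ⟩
      0#                                             ∎
      where
      step≤0 : (c : Covered⊎ i j (S t)) → step t c ≤ 0#
      step≤0 (inj₁ _)   = ≤-refl
      step≤0 (inj₂ f<1) = contradiction f<1 (<-irrefl f≈1)

    -- The step that covers the function contributes at most w; the earlier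
    -- ones contribute w x, where exp x is bounded by the ratio of the residuals.
    steps-uncovered : ∀ d t → f i j (S t) < 1# →
                      ∃[ x ] ExpBound x ε (y t) × steps d t ≤ w i j * (1# + x)
    -- With no steps left the exponent is 0, and the bound to show is ε ≤ y t.
    steps-uncovered ℕ.zero t f<1 = 0# , ExpBound-zero (ε≤1-f i j f<1) ,
      *-nonneg (0≤w i j) (+-nonneg 0≤1 ≤-refl)
    steps-uncovered (ℕ.suc d) t f<1 with step-ratio t (covered i j (S t)) f<1
    ... | u , step≈wu , 0≤u , uy≈y-y′ with covered i j (S (ℕ.suc t))
    ...   | inj₁ f′≈1 = 0# , ExpBound-zero (ε≤1-f i j f<1) , (begin
      step t (covered i j (S t)) + steps d (ℕ.suc t)
        ≤⟨ +-mono-≤ (≤-reflexive step≈wu) (steps-covered d (ℕ.suc t) f′≈1) ⟩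
      w i j * u + 0#      ≈⟨ +-identityʳ _ ⟩
      w i j * u           ≤⟨ *-monoʳ-≤ (0≤w i j) u≤1 ⟩
      w i j * 1#          ≈⟨ *-congˡ (+-identityʳ 1#) ⟨
      w i j * (1# + 0#)   ∎)
      where
      u≤1 : u ≤ 1#
      u≤1 = *-cancelʳ-≤ (x<y⇒0<y-x ℝ f<1) (≤-by (y (ℕ.suc t)) (x≤y⇒0≤y-x (f-≤1 i j _))
        (trans (+-congˡ (-‿cong uy≈y-y′)) (solve 2 (λ y z → :1 :* y :- (y :- z) := z)
             refl (y t) (y (ℕ.suc t)))))
    ...   | inj₂ f′<1 with steps-uncovered d (ℕ.suc t) f′<1
    ...     | x , bound , steps≤ = u + x ,
      ExpBound-step (<⇒≤ ε-pos) 0≤u (x<y⇒0<y-x ℝ f<1) (x<y⇒0<y-x ℝ f′<1) uy≈y-y′ bound , (begin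
      step t (covered i j (S t)) + steps d (ℕ.suc t) ≤⟨ +-mono-≤ (≤-reflexive step≈wu) steps≤ ⟩
      w i j * u + w i j * (1# + x)
        ≈⟨ solve 3 (λ w u x → w :* u :+ w :* (:1 :+ x) := w :* (:1 :+ (u :+ x))) refl (w i j) u x ⟩
      w i j * (1# + (u + x))       ∎)

    -- For an uncovered function the accumulated exponent x satisfies ε exp x ≤ y t ≤ 1, hence x ≤
    -- ln (1/ε). For a covered one both sides are compared with 0.
    steps-≤ : ∀ {ℓ} → IsLn ℝ (recip ℝ ε ε-pos) ℓ → ∀ d t →
              steps d t ≤ (1# + ℓ) * (w i j * uncovered (covered i j (S t)))
    steps-≤ {ℓ} isLn d t with covered i j (S t)
    ... | inj₁ f≈1 = begin
      steps d t               ≤⟨ steps-covered d t f≈1 ⟩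
      0#                      ≈⟨ solve 2 (λ l w → :0 := (:1 :+ l) :* (w :* :0)) refl ℓ (w i j) ⟩
      (1# + ℓ) * (w i j * 0#) ∎
    ... | inj₂ f<1 with steps-uncovered d t f<1
    ...   | x , (0≤x , bound) , steps≤ = begin
      steps d t               ≤⟨ steps≤ ⟩
      w i j * (1# + x)
        ≤⟨ *-monoʳ-≤ (0≤w i j) (+-monoʳ-≤ 1# (ExpBound⇒≤ln ε-pos (recip-inverseʳ ε ε-pos) isLn
                                   (0≤x , λ n → ≤-trans ℝ (bound n) y≤1))) ⟩
      w i j * (1# + ℓ)
        ≈⟨ solve 2 (λ w l → w :* (:1 :+ l) := (:1 :+ l) :* (w :* :1)) refl (w i j) ℓ ⟩
      (1# + ℓ) * (w i j * 1#) ∎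
      where
      y≤1 : y t ≤ 1#
      y≤1 = ≤-by (f i j (S t)) (f-nonneg i j (S t)) (solve 1 (λ f → :1 :- (:1 :- f) := f)
           refl (f i j (S t)))

-- Cover times as counts of uncovered prefixes, and sum against maximum over agents.

module Costs {c ℓ₁ ℓ₂ : Level} (ℝ : RealNumbers c ℓ₁ ℓ₂) {n k m : ℕ}
             .{{_ : NonZero n}} .{{_ : NonZero k}} (I : SRMA ℝ n k m) where
  open RealNumbers ℝ hiding (zero)
  open RealProperties ℝ
  open Logarithm ℝ
  open Summation ℝ
  open Marginals ℝ I
  open SRMA I
  open ≤-Reasoning

  totalWeight : Carrier
  totalWeight = ∑∑ w

  totalCost : Permutation′ n → Carrier
  totalCost π = ∑∑ λ i j → w i j * fromℕ (cov ℝ I i j π)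

  totalUncovered : Permutation′ n → Carrier
  totalUncovered π = sumFrom (λ t → uncoveredWeight (prefix π t)) n 0

  uncoveredSteps : ∀ (π : Permutation′ n) i j → Carrier
  uncoveredSteps π i j = sumFrom (λ t → uncovered (covered i j (prefix π t))) n 0

  totalUncovered≈ : ∀ π → totalUncovered π ≈ ∑∑ λ i j → w i j * uncoveredSteps π i j
  totalUncovered≈ π = trans (sumFrom-∑∑-comm (λ i j t → w i j * uncovered (covered i j (prefix π t))) n 0)
    (sum-cong-≋ λ i → sum-cong-≋ λ j → sym (*-distribˡ-sumFrom (w i j) _ n 0))

  -- The extra 1 accounts for functions that are already covered by ∅, whose
  -- cover time is 1 all the same.
  cov≤1+uncoveredSteps : ∀ π i j → fromℕ (cov ℝ I i j π) ≤ 1# + uncoveredSteps π i j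
  cov≤1+uncoveredSteps π i j with coverPosition ℝ I i j π
  ... | p , _ , p-least = +-monoʳ-≤ 1# (fromℕ≤sumFrom
    (λ q → uncovered-nonneg (covered i j (prefix π q))) 0 (ℕₚ.<⇒≤ (toℕ<n p))
    -- Minimality of p concerns the first q + 1 elements; monotonicity carries it over to the first
    -- q.
    λ q q<p → 1≤uncovered (λ f≈1 → not-covered q q<p
      (covered-⊆ i j (Prefix.prefix-mono-⊆ π (ℕₚ.n≤1+n q)) f≈1)) (covered i j (prefix π q)))
    where
    not-covered : ∀ q → q ℕ.< toℕ p → ¬ (f i j (prefix π (ℕ.suc q)) ≈ 1#)
    not-covered q q<p = ≡.subst (λ q → ¬ (f i j (prefix π (ℕ.suc q)) ≈ 1#)) (toℕ-fromℕ< q<n)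
      (p-least (fromℕ< q<n) (≡.subst (ℕ._< toℕ p) (≡.sym (toℕ-fromℕ< q<n)) q<p))
      where
      q<n : q ℕ.< n
      q<n = ℕₚ.<-trans q<p (toℕ<n p)

  -- Prefixes of length at least the cover time are covered, so only the shorter ones, the empty one
  -- included, can count.
  uncoveredSteps≤cov : ∀ π i j → uncoveredSteps π i j ≤ fromℕ (cov ℝ I i j π)
  uncoveredSteps≤cov π i j with coverPosition ℝ I i j π
  ... | p , f≈1 , _ = sumFrom≤fromℕ {c = ℕ.suc (toℕ p)} (λ q → uncovered-≤1 (covered i j (prefix π q)))
    (λ q p<q → uncovered-≤0 (covered-⊆ i j (Prefix.prefix-mono-⊆ π p<q) f≈1) (covered i j (prefix π q))) n 0

  totalCost≤ : ∀ π → totalCost π ≤ totalWeight + totalUncovered π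
  totalCost≤ π = begin
    totalCost π
      ≤⟨ ∑∑-mono-≤ (λ i j → *-monoʳ-≤ (0≤w i j) (cov≤1+uncoveredSteps π i j)) ⟩
    ∑∑ (λ i j → w i j * (1# + uncoveredSteps π i j))
      ≤⟨ ∑∑-mono-≤ (λ i j → ≤-reflexive (solve 2 (λ w u → w :* (:1 :+ u) := w :+ w :* u)
           refl _ _)) ⟩
    ∑∑ (λ i j → w i j + w i j * uncoveredSteps π i j)
      ≈⟨ ∑∑-distrib-+ w _ ⟩
    totalWeight + ∑∑ (λ i j → w i j * uncoveredSteps π i j)
      ≈⟨ +-congˡ (totalUncovered≈ π) ⟨
    totalWeight + totalUncovered π ∎

  totalUncovered≤ : ∀ π → totalUncovered π ≤ totalCost π
  totalUncovered≤ π = ≤-trans ℝ (≤-reflexive (totalUncovered≈ π))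
    (∑∑-mono-≤ λ i j → *-monoʳ-≤ (0≤w i j) (uncoveredSteps≤cov π i j))

  -- Every cover time is at least 1. This absorbs the extra weight in `totalCost≤`.
  totalWeight≤ : ∀ π → totalWeight ≤ totalCost π
  totalWeight≤ π = ∑∑-mono-≤ λ i j → ≤-by (w i j * fromℕ (toℕ (proj₁ (coverPosition ℝ I i j π))))
    (*-nonneg (0≤w i j) (0≤fromℕ (toℕ (proj₁ (coverPosition ℝ I i j π))))) (solve 2 (λ w p → w :* (:1 :+ p) :- w := w :* p)
         refl _ _)

  agentCost-nonneg : ∀ π i → 0# ≤ agentCost ℝ I π i
  agentCost-nonneg π i = sum-nonneg λ j → *-nonneg (0≤w i j) (0≤fromℕ (cov ℝ I i j π))

  totalCost-nonneg : ∀ π → 0# ≤ totalCost π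
  totalCost-nonneg π = sum-nonneg (agentCost-nonneg π)

  ⋁≤sum : ∀ {k} .{{_ : NonZero k}} {g : Fin k → Carrier} → (∀ i → 0# ≤ g i) → ⋁ ℝ g ≤ sum g
  ⋁≤sum {ℕ.suc ℕ.zero}    {g} 0≤g = ≤-reflexive (sym (+-identityʳ (g zero)))
  ⋁≤sum {ℕ.suc (ℕ.suc k)} {g} 0≤g = proj₂ (proj₂ (∨-supremum _ _)) _
    (≤-by (sum (g ∘ suc)) (sum-nonneg (0≤g ∘ suc)) (solve 2 (λ a b → a :+ b :- a := b) refl _ _))
    (≤-trans ℝ (⋁≤sum (0≤g ∘ suc)) (≤-by (g zero) (0≤g zero) (solve 2 (λ a b → a :+ b :- b := a)
         refl _ _)))

  -- The source of the factor k in the approximation ratio.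
  sum≤k*⋁ : ∀ {k} .{{_ : NonZero k}} (g : Fin k → Carrier) → sum g ≤ fromℕ k * ⋁ ℝ g
  sum≤k*⋁ {ℕ.suc ℕ.zero}    g = ≤-reflexive (solve 1 (λ a → a :+ :0 := (:1 :+ :0) :* a) refl _)
  sum≤k*⋁ {ℕ.suc (ℕ.suc k)} g = begin
    g zero + sum (g ∘ suc)
      ≤⟨ +-mono-≤ (proj₁ (∨-supremum _ _)) (≤-trans ℝ (sum≤k*⋁ (g ∘ suc))
                                                   (*-monoʳ-≤ (0≤fromℕ (ℕ.suc k)) (proj₁ (proj₂ (∨-supremum _ _))))) ⟩
    ⋁ ℝ g + fromℕ (ℕ.suc k) * ⋁ ℝ g
      ≈⟨ solve 2 (λ x k → x :+ k :* x := (:1 :+ k) :* x) refl _ _ ⟩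
    fromℕ (ℕ.suc (ℕ.suc k)) * ⋁ ℝ g           ∎

  -- Comparison of a greedy permutation with an arbitrary one, and with the optimum.

  module Greedy (π : Permutation′ n) (greedy : NormalizedGreedy ℝ I π)
                {ℓ} (isLn : IsLn ℝ (recip ℝ ε ε-pos) ℓ) where
    S : ℕ → Subset n
    S = prefix π

    -- The quantity P t, taken with the whole next prefix in place of the chosen element, so that
    -- the terms of one function follow a chain of sets.
    stepGain : ℕ → Carrier
    stepGain t = gain (S t) (S (ℕ.suc t))

    0≤ℓ : 0# ≤ ℓ
    0≤ℓ = ExpBound⇒≤ln ε-pos (recip-inverseʳ ε ε-pos) isLn (ExpBound-zero ε≤1)

    -- The greedy rule ranks only elements not yet chosen; one already chosen has no gain.
    gain≤stepGain′ : ∀ p e → gain (S (toℕ p)) ⁅ e ⁆ ≤ stepGain (toℕ p)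
    gain≤stepGain′ p e with e ∈? S (toℕ p)
    ... | yes e∈S = ≤-trans ℝ (gain-⊆ (S (toℕ p)) λ x∈ → ≡.subst (_∈ S (toℕ p)) (≡.sym (x∈⁅y⁆⇒x≡y e x∈)) e∈S)
                      (gain-nonneg (S (toℕ p)) _)
    ... | no  e∉S = ≤-trans ℝ (greedy p e e∉S) (gain-mono (S (toℕ p)) (Prefix.⁅⁆-⊆-prefix π p))

    gain≤stepGain : ∀ {t} → t ℕ.< n → ∀ e → gain (S t) ⁅ e ⁆ ≤ stepGain t
    gain≤stepGain t<n e = ≡.subst (λ t → gain (S t) ⁅ e ⁆ ≤ stepGain t) (toℕ-fromℕ< t<n) (gain≤stepGain′ (fromℕ< t<n) e)

    stepGain-tail : ∀ d t → sumFrom stepGain d t ≤ (1# + ℓ) * uncoveredWeight (S t)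
    stepGain-tail d t = begin
      sumFrom stepGain d t
        ≈⟨ sumFrom-∑∑-comm (λ i j t → marginal i j (S t) (S (ℕ.suc t)) (covered i j (S t))) d t ⟩
      ∑∑ (λ i j → sumFrom (λ t → marginal i j (S t) (S (ℕ.suc t)) (covered i j (S t))) d t)
        ≤⟨ ∑∑-mono-≤ (λ i j → steps-≤ S (λ t → Prefix.prefix-mono-⊆ π (ℕₚ.n≤1+n t)) i j isLn d t) ⟩
      ∑∑ (λ i j → (1# + ℓ) * (w i j * uncovered (covered i j (S t))))
        ≈⟨ *-distribˡ-∑∑ (1# + ℓ) _ ⟨
      (1# + ℓ) * uncoveredWeight (S t) ∎

    uncoveredWeight-nonneg : ∀ T → 0# ≤ uncoveredWeight T
    uncoveredWeight-nonneg T = ∑∑-nonneg λ i j → *-nonneg (0≤w i j) (uncovered-nonneg (covered i j T))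

    module _ (σ : Permutation′ n) where
      uncoveredWeight-full : uncoveredWeight (prefix σ n) ≤ 0#
      uncoveredWeight-full = begin
        uncoveredWeight (prefix σ n) ≡⟨ ≡.cong uncoveredWeight (prefix-full σ) ⟩
        uncoveredWeight ⊤            ≤⟨ ∑∑-mono-≤ (λ i j → ≤-trans ℝ
                                          (*-monoʳ-≤ (0≤w i j) (uncovered-≤0 (f-⊤ i j) (covered i j ⊤)))
                                          (≤-reflexive (zeroʳ (w i j)))) ⟩
        ∑∑ (λ _ _ → 0#)
          ≈⟨ trans (sum-cong-≋ {k} λ _ → sum-replicate-zero m) (sum-replicate-zero k) ⟩
        0#                           ∎

      uncoveredWeight-≤ : ∀ {s t} → t ℕ.< n → s ℕ.≤ n →
        uncoveredWeight (S t) ≤ fromℕ s * stepGain t + uncoveredWeight (prefix σ s)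
      uncoveredWeight-≤ {s} {t} t<n s≤n = ≤-trans ℝ (uncoveredWeight-split (S t) (prefix σ s))
        (+-monoˡ-≤ _ (gain-prefix σ (S t) (gain≤stepGain t<n) s s≤n))

      totalUncovered-≤ : totalUncovered π ≤ fromℕ 4 * (1# + ℓ) * totalUncovered σ
      totalUncovered-≤ = begin
        totalUncovered π
          -- Starting at s = 0 makes the term with P vanish, and lengths n make both remaining sums
          -- complete.
          ≤⟨ histogram (+-nonneg 0≤1 0≤ℓ) (λ t → uncoveredWeight-nonneg (S t)) (λ t → gain-nonneg (S t) _)
               (λ s → uncoveredWeight-nonneg (prefix σ s)) uncoveredWeight-full (λ d t _ → stepGain-tail d t)
               uncoveredWeight-≤ n 0 ≡.refl n 0 ≡.refl ⟩
        fromℕ 2 * 0# * sumFrom stepGain n 0 + fromℕ 4 * (1# + ℓ) * totalUncovered σ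
          ≈⟨ solve 3 (λ a p x → a :* :0 :* p :+ x := x) refl (fromℕ 2) (sumFrom stepGain n 0) _ ⟩
        fromℕ 4 * (1# + ℓ) * totalUncovered σ ∎

      totalCost-≤ : totalCost π ≤ (fromℕ 4 * ℓ + fromℕ 8) * totalCost σ
      totalCost-≤ = begin
        totalCost π                      ≤⟨ totalCost≤ π ⟩
        totalWeight + totalUncovered π   ≤⟨ +-mono-≤ (totalWeight≤ σ) totalUncovered-≤ ⟩
        C + fromℕ 4 * (1# + ℓ) * totalUncovered σ
          ≤⟨ +-monoʳ-≤ C (*-monoʳ-≤ (*-nonneg (0≤fromℕ 4) (+-nonneg 0≤1 0≤ℓ)) (totalUncovered≤ σ)) ⟩
        C + fromℕ 4 * (1# + ℓ) * C
          -- The factor obtained is 1 + 4 (1 + ℓ) = 4 ℓ + 5, so 3 C is slack.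
          ≤⟨ ≤-by (fromℕ 3 * C) (*-nonneg (0≤fromℕ 3) (totalCost-nonneg σ))
               (solve 2 (λ l c →
                  let three = :1 :+ (:1 :+ (:1 :+ :0))
                      four  = :1 :+ three
                      eight = :1 :+ (:1 :+ (:1 :+ (:1 :+ four))) in
                  (four :* l :+ eight) :* c :- (c :+ four :* (:1 :+ l) :* c) := three :* c) refl ℓ C) ⟩
        (fromℕ 4 * ℓ + fromℕ 8) * C      ∎
        where C = totalCost σ

    factor : Carrier
    factor = fromℕ (4 ℕ.* k) * ℓ + fromℕ (8 ℕ.* k)

    factor≈ : factor ≈ (fromℕ 4 * ℓ + fromℕ 8) * fromℕ k
    factor≈ = trans (+-cong (*-congʳ (×1-homo-* 4 k)) (×1-homo-* 8 k))
      (solve 4 (λ a b l k → a :* k :* l :+ b :* k := (a :* l :+ b) :* k)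
           refl (fromℕ 4) (fromℕ 8) ℓ (fromℕ k))

    0≤4ℓ+8 : 0# ≤ fromℕ 4 * ℓ + fromℕ 8
    0≤4ℓ+8 = +-nonneg (*-nonneg (0≤fromℕ 4) 0≤ℓ) (0≤fromℕ 8)

    0<factor : 0# < factor
    0<factor = <-≤-trans (0<fromℕ[1+n] ℝ 0) (begin
      fromℕ 1                       ≤⟨ fromℕ-mono-≤ (ℕ.>-nonZero⁻¹ k) ⟩
      fromℕ k                       ≤⟨ fromℕ-mono-≤ (ℕₚ.m≤m+n k (7 ℕ.* k)) ⟩
      fromℕ (8 ℕ.* k)               ≈⟨ +-identityˡ _ ⟨
      0# + fromℕ (8 ℕ.* k)          ≤⟨ +-monoˡ-≤ _ (*-nonneg (0≤fromℕ (4 ℕ.* k)) 0≤ℓ) ⟩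
      factor                        ∎)

    objective-≤ : ∀ σ → objective ℝ I π ≤ factor * objective ℝ I σ
    objective-≤ σ = begin
      objective ℝ I π                                      ≤⟨ ⋁≤sum (agentCost-nonneg π) ⟩
      totalCost π                                          ≤⟨ totalCost-≤ σ ⟩
      (fromℕ 4 * ℓ + fromℕ 8) * totalCost σ
        ≤⟨ *-monoʳ-≤ 0≤4ℓ+8 (sum≤k*⋁ (agentCost ℝ I σ)) ⟩
      (fromℕ 4 * ℓ + fromℕ 8) * (fromℕ k * objective ℝ I σ) ≈⟨ *-assoc _ _ _ ⟨
      (fromℕ 4 * ℓ + fromℕ 8) * fromℕ k * objective ℝ I σ  ≈⟨ *-congʳ factor≈ ⟨
      factor * objective ℝ I σ                             ∎

    -- After division by the positive `factor`, the cost of π is a lower bound for the objective of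
    -- every σ, hence for their minimum.
    objective-≤-OPT : objective ℝ I π ≤ factor * OPT ℝ I
    objective-≤-OPT = begin
      objective ℝ I π                         ≈⟨ factor*[1/factor*x] (objective ℝ I π) ⟨
      factor * (r * objective ℝ I π)
        ≤⟨ *-monoʳ-≤ (<⇒≤ 0<factor) (minPerm-glb ℝ n (objective ℝ I) λ σ →
        ≤-trans ℝ (*-monoʳ-≤ (<⇒≤ (0<recip factor 0<factor)) (objective-≤ σ))
          (≤-reflexive (trans (solve 3 (λ r f x → r :* (f :* x) := f :* (r :* x)) refl r factor _)
            (factor*[1/factor*x] (objective ℝ I σ))))) ⟩
      factor * OPT ℝ I                        ∎
      where
      r = recip ℝ factor 0<factor
      factor*[1/factor*x] : ∀ x → factor * (r * x) ≈ x
      factor*[1/factor*x] x = trans (sym (*-assoc factor r x))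
        (trans (*-congʳ (recip-inverseʳ factor 0<factor)) (*-identityˡ x))

theorem2 : ∀ {c ℓ₁ ℓ₂} (ℝ : RealNumbers c ℓ₁ ℓ₂) → let open RealNumbers ℝ in
    ∀ {n k m : ℕ} .{{_ : NonZero n}} .{{_ : NonZero k}} (I : SRMA ℝ n k m)
    (π : Permutation′ n) → NormalizedGreedy ℝ I π →
    ∀ ln[1/ε] → IsLn ℝ (recip ℝ (SRMA.ε I) (SRMA.ε-pos I)) ln[1/ε] →
    objective ℝ I π ≤ (fromℕ (4 ℕ.* k) * ln[1/ε] + fromℕ (8 ℕ.* k)) * OPT ℝ I
theorem2 ℝ I π greedy _ isLn = Costs.Greedy.objective-≤-OPT ℝ I π greedy isLn
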